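{- With $B(n)$ and $B'(n)$ as defined in the context: (a) $$\sum_{n\ge1}B(n)q^n=\frac{2q(-q^2;q)_\infty(-q^4;q)_\infty}{(q^2;q^4)_\infty(q^6;q^4)_\infty}-\frac{q}{(1+q)(1+q^3)}=\frac{2q(-q^2;q)_\infty(-q^4;q)_\infty}{(q^2;q^4)_\infty(q^6;q^4)_\infty}+\sum_{n\ge1}(-1)^n\left\lfloor\frac{n+2}{3}\right\rfloor q^n;$$ (b) $$\sum_{n\ge1}B'(n)q^n=\frac{q}{(1-q)(1-q^3)}=\sum_{n\ge1}\left\lfloor\frac{n+2}{3}\right\rfloor q^n.$$
   Context: $(a;q)_\infty=\prod_{j\ge0}(1-aq^j)$, $|q|<1$. A two-color partition is a partition whose parts are each colored blue or green (the same integer may occur in both colors). For a positive integer $n$, $B(n)$ is the number of two-color partitions of $n$ in which: the smallest part $s$ is odd and blue, every other blue odd part is at least $s+2$, and every blue even part is at least $s+4$; no even integer occurs more than once in the same color (odd parts may repeat). $B_0(n)$ (resp. $B_1(n)$) is the number of partitions counted by $B(n)$ whose total number of even parts is even (resp. odd), and $B'(n)=B_0(n)-B_1(n)$. Equivalently, $\sum_{n\ge1}B(n)q^n=\sum_{n\ge0}q^{2n+1}\frac{(-q^{2n+6};q^2)_\infty(-q^{2n+2};q^2)_\infty}{(q^{2n+3};q^2)_\infty(q^{2n+1};q^2)_\infty}$ and $\sum_{n\ge1}B'(n)q^n=\sum_{n\ge0}q^{2n+1}\frac{(q^{2n+6};q^2)_\infty(q^{2n+2};q^2)_\infty}{(q^{2n+3};q^2)_\infty(q^{2n+1};q^2)_\infty}$.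 -}

module Defs where

open import Data.Nat as ℕ using (ℕ; zero; suc; _∸_; _⊓_; _≤ᵇ_; _≡ᵇ_; _%_; _/_)
open import Data.Integer as ℤ using (ℤ; +_)
open import Data.Bool using (Bool; true; false; _∧_; _∨_; not; if_then_else_)
open import Data.List using (List; []; _∷_; [_]; map; concatMap; foldr; upTo; reverse; length; _++_)
open import Data.Product using (_×_; _,_)

range : ℕ → ℕ → List ℕ
range a b = map (a ℕ.+_) (upTo (suc b ∸ a))

-- pts fuel n m : all partitions of n into positive parts ≤ m, as
-- nonincreasing lists (fuel ≥ n suffices)
pts : ℕ → ℕ → ℕ → List (List ℕ)
pts _        zero    _ = [ [] ]
pts zero     (suc n) _ = []
pts (suc f)  (suc n) m =
  concatMap (λ k → map (k ∷_) (pts f (suc n ∸ k) k)) (range 1 (m ⊓ suc n))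

partitions : ℕ → List (List ℕ)
partitions n = pts n n n

-- A two-color partition = (blue parts , green parts); the two color classes
-- are ordinary partitions whose sizes add up to n.
TwoColor : Set
TwoColor = List ℕ × List ℕ

twoColorPartitions : ℕ → List TwoColor
twoColorPartitions n =
  concatMap (λ m → concatMap (λ b → map (b ,_) (partitions (n ∸ m))) (partitions m))
            (upTo (suc n))

isEven : ℕ → Bool
isEven p = p % 2 ≡ᵇ 0

allB : {A : Set} → (A → Bool) → List A → Bool
allB P = foldr (λ x r → P x ∧ r) true

countB : {A : Set} → (A → Bool) → List A → ℕ
countB P = foldr (λ x r → if P x then suc r else r) 0

filterB : {A : Set} → (A → Bool) → List A → List A
filterB P = foldr (λ x r → if P x then x ∷ r else r) []

evensDistinct : List ℕ → Bool
evensDistinct l = allB (λ p → not (isEven p) ∨ (countB (p ≡ᵇ_) l ≤ᵇ 1)) l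

-- the conditions defining B(n).  Blue parts are nonincreasing, so the last
-- blue part s is the smallest blue part; requiring all green parts ≥ s makes
-- s the smallest part overall.
isB : TwoColor → Bool
isB (b , g) with reverse b
... | []       = false
... | s ∷ rest =
  not (isEven s)
  ∧ allB (s ≤ᵇ_) g
  ∧ allB (λ p → if isEven p then suc (suc (suc (suc s))) ≤ᵇ p
                             else suc (suc s) ≤ᵇ p) rest
  ∧ evensDistinct b
  ∧ evensDistinct g

Bset : ℕ → List TwoColor
Bset n = filterB isB (twoColorPartitions n)

B : ℕ → ℕ
B n = length (Bset n)

numEven : TwoColor → ℕ
numEven (b , g) = countB isEven (b ++ g)

-- B'(n) = B₀(n) − B₁(n)
B' : ℕ → ℤ
B' n = foldr (λ π r → (ℤ.- ℤ.1ℤ) ℤ.^ numEven π ℤ.+ r) ℤ.0ℤ (Bset n)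

Series : Set
Series = ℕ → ℤ

sumℤ : List ℤ → ℤ
sumℤ = foldr ℤ._+_ ℤ.0ℤ

_⊛_ : Series → Series → Series
(f ⊛ g) n = sumℤ (map (λ i → f i ℤ.* g (n ∸ i)) (upTo (suc n)))

oneS : Series
oneS zero    = ℤ.1ℤ
oneS (suc _) = ℤ.0ℤ

qS : Series → Series
qS f zero    = ℤ.0ℤ
qS f (suc n) = f n

lin : ℤ → ℕ → Series
lin c k n = (if n ≡ᵇ 0 then ℤ.1ℤ else ℤ.0ℤ) ℤ.+ (if n ≡ᵇ k then c else ℤ.0ℤ)

-- 1 / (1 - c q^k) = Σ_m c^m q^{km}   (k ≥ 1)
geom : ℤ → ℕ → Series
geom c k n = sumℤ (map (λ m → if k ℕ.* m ≡ᵇ n then c ℤ.^ m else ℤ.0ℤ) (upTo (suc n)))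

finProd : List Series → Series
finProd = foldr _⊛_ oneS

-- Infinite product ∏_{j≥0} F j, computed coefficientwise.  Valid (and used
-- only) when F j ≡ 1 mod q^{j+1}, so that the coefficient of q^n only
-- depends on the factors F 0, …, F n.
infProd : (ℕ → Series) → Series
infProd F n = finProd (map F (upTo (suc n))) n

-- (c q^a ; q^d)_∞ with c = ±1 given as the sign σ in  ∏ (1 + σ q^{a+dj})
-- i.e. (−q^a;q^d)_∞ = poch ℤ.1ℤ a d, (q^a;q^d)_∞ = poch (ℤ.- ℤ.1ℤ) a d
poch : ℤ → ℕ → ℕ → Series
poch σ a d = infProd (λ j → lin σ (a ℕ.+ d ℕ.* j))

invPochMinus : ℕ → ℕ → Series
invPochMinus a d = infProd (λ j → geom ℤ.1ℤ (a ℕ.+ d ℕ.* j))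

-- generating functions Σ_{n≥1} B(n) q^n and Σ_{n≥1} B'(n) q^n
-- (B 0 = 0 and B' 0 = 0 automatically, since blue must be nonempty)
genB : Series
genB n = + B n

genB' : Series
genB' n = B' n

mainProd : Series
mainProd = poch ℤ.1ℤ 2 1 ⊛ (poch ℤ.1ℤ 4 1 ⊛ (invPochMinus 2 4 ⊛ invPochMinus 6 4))

twoQMain : Series
twoQMain n = (+ 2) ℤ.* qS mainProd n

qOver1p : Series
qOver1p = qS (geom (ℤ.- ℤ.1ℤ) 1 ⊛ geom (ℤ.- ℤ.1ℤ) 3)

qOver1m : Series
qOver1m = qS (geom ℤ.1ℤ 1 ⊛ geom ℤ.1ℤ 3)

-- ⌊(n+2)/3⌋ (its value at n = 0 is 0, so Σ_{n≥1} = Σ_{n≥0})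
floorSeq : ℕ → ℕ
floorSeq n = (n ℕ.+ 2) / 3

altFloorS : Series
altFloorS n = (ℤ.- ℤ.1ℤ) ℤ.^ n ℤ.* (+ floorSeq n)

floorS : Series
floorS n = + floorSeq n

{-# OPTIONS --safe #-}
module Submission where

-- Let w = ±1 weight the even parts and let t_j be the generating function of the partitions with
-- smallest part 2j+1.  Writing (a)_∞ = (a;q²)_∞ and
--   U_j = (−wq^{2j})_∞ (−wq^{2j+4})_∞ / ((q^{2j+1})_∞ (q^{2j+3})_∞),
-- one has (1+wq)(1+wq³) t_j = wq (U_j − U_{j+1}), so the sum telescopes to wq (U_0 − 1).  For w = −1
-- the factor 1 + w of U_0 vanishes; for w = 1 it is the 2 in the formula, and the remaining product
-- is rearranged by (−a;q)_∞ = (−a;q²)_∞ (−aq;q²)_∞ and (a²;q⁴)_∞ = (a;q²)_∞ (−a;q²)_∞.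

open import Defs
open import Algebra.Bundles using (CommutativeRing)
import Algebra.Solver.Ring
open import Algebra.Solver.Ring.AlmostCommutativeRing
  using (fromCommutativeRing; _-Raw-AlmostCommutative⟶_)
open import Data.Bool using (Bool; true; false; if_then_else_; _∧_; _∨_; not; T)
open import Data.Bool.Properties using (∨-zeroʳ; ∧-zeroʳ; ∧-comm; ∧-assoc; ∧-identityʳ)
open import Data.Integer as ℤ using (ℤ; 0ℤ; 1ℤ; _+_; _-_; _*_; -_)
import Data.Integer.Properties as ℤₚ
open import Data.Integer.Tactic.RingSolver using (solve-∀)
open import Data.List
  using (List; []; _∷_; map; upTo; applyUpTo; concatMap; foldr; _++_; _∷ʳ_; reverse; initLast; _∷ʳ′_; length)
open import Data.List.Properties using (map-upTo; map-∘; unfold-reverse; reverse-++)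
open import Data.List.Relation.Unary.All as All using (All; []; _∷_)
import Data.List.Relation.Unary.All.Properties as Allₚ
open import Data.Maybe using (Maybe; just; nothing)
open import Data.Nat as ℕ using (ℕ; zero; suc; z≤n; s≤s; _∸_; _≡ᵇ_; _≤ᵇ_; _⊓_)
open import Data.Nat.Divisibility using (∣-refl)
open import Data.Nat.DivMod using (+-distrib-/-∣ˡ)
import Data.Nat.Properties as ℕₚ
open import Data.Nat.Tactic.RingSolver using () renaming (solve-∀ to ℕ-solve-∀)
open import Data.Product using (_,_; ∃; _×_)
open import Data.Sum using (_⊎_; inj₁; inj₂)
open import Data.Unit using (tt)
open import Function using (_∘_)
import Relation.Binary.Reasoning.Setoid
open import Relation.Binary.PropositionalEquality
  using (_≡_; _≢_; _≗_; refl; sym; trans; cong; cong₂; subst; module ≡-Reasoning)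
open import Relation.Nullary using (Dec; yes; no; contradiction)

-- The ring of formal power series

-- Why the difference of two consecutive `U` is a single term: put a = q^{2j} and t_j = q a D. As s
-- = 2j+1 is odd, blue even parts start at s+5, so the factor for s+3 is missing from D, and U_j =
-- (1+wa)(1+wq⁴a) D, while U_{j+1} = (1-qa)(1-q³a) D. The terms in a² are w²q⁴ and q⁴; they cancel
-- exactly because w² = 1, and what is left is w a (1+wq)(1+wq³) D. The -1 in U_0 - 1 is the limit
-- of U_j, which is 1 modulo q^j. The objects are computational: partitions are enumerated from the
-- largest part down, while the condition on blue parts is read from the smallest one, and an
-- infinite product is cut at a length that depends on the coefficient. Hence partitions are summed
-- against an arbitrary weight on lists, which makes the recursion on the largest part closed, the
-- blue condition is restated so that it can be read from the largest part, and every identity of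
-- infinite products is obtained from finite products of one common length.

∑ : ℕ → (ℕ → ℤ) → ℤ
∑ zero    h = 0ℤ
∑ (suc n) h = h 0 + ∑ n (h ∘ suc)

∑-cong : ∀ n {h k} → (∀ i → i ℕ.< n → h i ≡ k i) → ∑ n h ≡ ∑ n k
∑-cong zero    e = refl
∑-cong (suc n) e = cong₂ _+_ (e 0 (s≤s z≤n)) (∑-cong n (λ i i<n → e (suc i) (s≤s i<n)))

∑-0 : ∀ n {h} → (∀ i → i ℕ.< n → h i ≡ 0ℤ) → ∑ n h ≡ 0ℤ
∑-0 zero    e = refl
∑-0 (suc n) e rewrite e 0 (s≤s z≤n) | ∑-0 n (λ i i<n → e (suc i) (s≤s i<n)) = refl

∑-last : ∀ n h → ∑ (suc n) h ≡ ∑ n h + h n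
∑-last zero    h = ℤₚ.+-comm (h 0) 0ℤ
∑-last (suc n) h = trans (cong (h 0 +_) (∑-last n (h ∘ suc))) (sym (ℤₚ.+-assoc (h 0) _ _))

∑-+ : ∀ n h k → ∑ n (λ i → h i + k i) ≡ ∑ n h + ∑ n k
∑-+ zero    h k = refl
∑-+ (suc n) h k = trans (cong (h 0 + k 0 +_) (∑-+ n (h ∘ suc) (k ∘ suc))) (swap (h 0) (k 0) _ _)
  where
  swap : ∀ a b c d → (a + b) + (c + d) ≡ (a + c) + (b + d)
  swap = solve-∀

∑-*ˡ : ∀ n c h → ∑ n (λ i → c * h i) ≡ c * ∑ n h
∑-*ˡ zero    c h = sym (ℤₚ.*-zeroʳ c)
∑-*ˡ (suc n) c h =
  trans (cong (c * h 0 +_) (∑-*ˡ n c (h ∘ suc))) (sym (ℤₚ.*-distribˡ-+ c (h 0) _))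

∑-truncate : ∀ {n m h} → n ℕ.≤ m → (∀ i → n ℕ.≤ i → h i ≡ 0ℤ) → ∑ m h ≡ ∑ n h
∑-truncate {m = m} z≤n e = ∑-0 m (λ i _ → e i z≤n)
∑-truncate {h = h} (s≤s n≤m) e = cong (h 0 +_) (∑-truncate n≤m (λ i n≤i → e (suc i) (s≤s n≤i)))

sumℤ-applyUpTo : ∀ n h → sumℤ (applyUpTo h n) ≡ ∑ n h
sumℤ-applyUpTo zero    h = refl
sumℤ-applyUpTo (suc n) h = cong (h 0 +_) (sumℤ-applyUpTo n (h ∘ suc))

sumℤ-map-upTo : ∀ n h → sumℤ (map h (upTo n)) ≡ ∑ n h
sumℤ-map-upTo n h = trans (cong sumℤ (map-upTo h n)) (sumℤ-applyUpTo n h)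

infix 4 _≈_
-- A record rather than bare pointwise equality, so that both series can be recovered from the type
-- of a proof.
record _≈_ (f g : Series) : Set where
  constructor coeffs
  field at : f ≗ g
open _≈_ public

infixl 6 _⊞_
_⊞_ : Series → Series → Series
(f ⊞ g) n = f n + g n

⊟_ : Series → Series
(⊟ f) n = - f n

0S : Series
0S _ = 0ℤ

const : ℤ → Series
const c zero    = c
const c (suc _) = 0ℤ

⊛-∑ : ∀ f g n → (f ⊛ g) n ≡ ∑ (suc n) (λ i → f i * g (n ∸ i))
⊛-∑ f g n = sumℤ-map-upTo (suc n) (λ i → f i * g (n ∸ i))

⊛-zero : ∀ f g → (f ⊛ g) 0 ≡ f 0 * g 0
⊛-zero f g = ℤₚ.+-identityʳ _

⊛-suc : ∀ f g n → (f ⊛ g) (suc n) ≡ f 0 * g (suc n) + ((f ∘ suc) ⊛ g) n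
⊛-suc f g n = trans (⊛-∑ f g (suc n)) (cong (f 0 * g (suc n) +_) (sym (⊛-∑ (f ∘ suc) g n)))

-- The locality of multiplication: this is what allows an infinite product or sum inside a product
-- to be exchanged for a truncation that is correct up to degree `n`.
⊛-cong-≤ : ∀ {f f′ g g′} n → (∀ i → i ℕ.≤ n → f i ≡ f′ i) → (∀ i → i ℕ.≤ n → g i ≡ g′ i) →
           (f ⊛ g) n ≡ (f′ ⊛ g′) n
⊛-cong-≤ {f} {f′} {g} {g′} n p q = begin
  (f ⊛ g) n                              ≡⟨ ⊛-∑ f g n ⟩
  ∑ (suc n) (λ i → f i * g (n ∸ i))
    ≡⟨ ∑-cong (suc n) (λ { i (s≤s i≤n) → cong₂ _*_ (p i i≤n) (q (n ∸ i) (ℕₚ.m∸n≤m n i)) }) ⟩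
  ∑ (suc n) (λ i → f′ i * g′ (n ∸ i))    ≡⟨ ⊛-∑ f′ g′ n ⟨
  (f′ ⊛ g′) n                            ∎
  where open ≡-Reasoning

⊛-cong : ∀ {f f′ g g′} → f ≈ f′ → g ≈ g′ → f ⊛ g ≈ f′ ⊛ g′
⊛-cong {f} {f′} {g} {g′} p q = coeffs λ n → ⊛-cong-≤ {f} {f′} {g} {g′} n (λ i _ → at p i) (λ i _ → at q i)

-- The mirror image of `⊛-suc`, peeling off the constant term of the second factor. Commutativity
-- follows by induction because exchanging the factors turns one recursion into the other.
⊛-suc′ : ∀ f g n → (f ⊛ g) (suc n) ≡ (f ⊛ (g ∘ suc)) n + f (suc n) * g 0
⊛-suc′ f g zero = begin
  (f ⊛ g) 1                              ≡⟨ ⊛-suc f g 0 ⟩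
  f 0 * g 1 + ((f ∘ suc) ⊛ g) 0          ≡⟨ cong₂ _+_ (sym (⊛-zero f (g ∘ suc))) (⊛-zero (f ∘ suc) g) ⟩
  (f ⊛ (g ∘ suc)) 0 + f 1 * g 0          ∎
  where open ≡-Reasoning
⊛-suc′ f g (suc n) = begin
  (f ⊛ g) (suc (suc n))                                            ≡⟨ ⊛-suc f g (suc n) ⟩
  a + ((f ∘ suc) ⊛ g) (suc n)                                      ≡⟨ cong (a +_) (⊛-suc′ (f ∘ suc) g n) ⟩
  a + (((f ∘ suc) ⊛ (g ∘ suc)) n + b)                              ≡⟨ ℤₚ.+-assoc a _ b ⟨
  (a + ((f ∘ suc) ⊛ (g ∘ suc)) n) + b                              ≡⟨ cong (_+ b) (⊛-suc f (g ∘ suc) n) ⟨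
  (f ⊛ (g ∘ suc)) (suc n) + b                                      ∎
  where
  open ≡-Reasoning
  a = f 0 * g (suc (suc n))
  b = f (suc (suc n)) * g 0

⊛-comm′ : ∀ f g n → (f ⊛ g) n ≡ (g ⊛ f) n
⊛-comm′ f g zero    = trans (⊛-zero f g) (trans (ℤₚ.*-comm (f 0) (g 0)) (sym (⊛-zero g f)))
⊛-comm′ f g (suc n) = begin
  (f ⊛ g) (suc n)                          ≡⟨ ⊛-suc f g n ⟩
  f 0 * g (suc n) + ((f ∘ suc) ⊛ g) n      ≡⟨ cong₂ _+_ (ℤₚ.*-comm (f 0) _) (⊛-comm′ (f ∘ suc) g n) ⟩
  g (suc n) * f 0 + (g ⊛ (f ∘ suc)) n      ≡⟨ ℤₚ.+-comm (g (suc n) * f 0) _ ⟩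
  (g ⊛ (f ∘ suc)) n + g (suc n) * f 0      ≡⟨ ⊛-suc′ g f n ⟨
  (g ⊛ f) (suc n)                          ∎
  where open ≡-Reasoning

⊛-distribʳ′ : ∀ h f g n → ((f ⊞ g) ⊛ h) n ≡ (f ⊛ h) n + (g ⊛ h) n
⊛-distribʳ′ h f g n = begin
  ((f ⊞ g) ⊛ h) n                                                  ≡⟨ ⊛-∑ (f ⊞ g) h n ⟩
  ∑ (suc n) (λ i → (f i + g i) * h (n ∸ i))                        ≡⟨ ∑-cong (suc n) (λ i _ → ℤₚ.*-distribʳ-+ (h (n ∸ i)) (f i) (g i)) ⟩
  ∑ (suc n) (λ i → f i * h (n ∸ i) + g i * h (n ∸ i))              ≡⟨ ∑-+ (suc n) (λ i → f i * h (n ∸ i)) (λ i → g i * h (n ∸ i)) ⟩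
  ∑ (suc n) (λ i → f i * h (n ∸ i)) + ∑ (suc n) (λ i → g i * h (n ∸ i))
                                                                   ≡⟨ cong₂ _+_ (⊛-∑ f h n) (⊛-∑ g h n) ⟨
  (f ⊛ h) n + (g ⊛ h) n                                            ∎
  where open ≡-Reasoning

⊛-scaleˡ : ∀ c f g n → ((λ i → c * f i) ⊛ g) n ≡ c * (f ⊛ g) n
⊛-scaleˡ c f g n = begin
  ((λ i → c * f i) ⊛ g) n                    ≡⟨ ⊛-∑ (λ i → c * f i) g n ⟩
  ∑ (suc n) (λ i → c * f i * g (n ∸ i))      ≡⟨ ∑-cong (suc n) (λ i _ → ℤₚ.*-assoc c (f i) (g (n ∸ i))) ⟩
  ∑ (suc n) (λ i → c * (f i * g (n ∸ i)))    ≡⟨ ∑-*ˡ (suc n) c (λ i → f i * g (n ∸ i)) ⟩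
  c * ∑ (suc n) (λ i → f i * g (n ∸ i))      ≡⟨ cong (c *_) (⊛-∑ f g n) ⟨
  c * (f ⊛ g) n                              ∎
  where open ≡-Reasoning

-- Induction on the degree for all series at once: the tail of `f ⊛ g` is a multiple of the tail of
-- `g` plus `(f ∘ suc) ⊛ g`, so the induction hypothesis is needed at `f ∘ suc`.
⊛-assoc′ : ∀ f g h n → ((f ⊛ g) ⊛ h) n ≡ (f ⊛ (g ⊛ h)) n
⊛-assoc′ f g h zero
  rewrite ⊛-zero (f ⊛ g) h | ⊛-zero f g | ⊛-zero f (g ⊛ h) | ⊛-zero g h = ℤₚ.*-assoc (f 0) _ _
⊛-assoc′ f g h (suc n) = begin
  ((f ⊛ g) ⊛ h) (suc n)                                             ≡⟨ ⊛-suc (f ⊛ g) h n ⟩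
  (f ⊛ g) 0 * h (suc n) + (((f ⊛ g) ∘ suc) ⊛ h) n
    ≡⟨ cong₂ _+_ (cong (_* h (suc n)) (⊛-zero f g)) (⊛-cong-≤ {g = h} n (λ i _ → ⊛-suc f g i) (λ _ _ → refl)) ⟩
  f 0 * g 0 * h (suc n) + ((s ⊞ (f ∘ suc) ⊛ g) ⊛ h) n               ≡⟨ cong (f 0 * g 0 * h (suc n) +_) (⊛-distribʳ′ h s ((f ∘ suc) ⊛ g) n) ⟩
  f 0 * g 0 * h (suc n) + ((s ⊛ h) n + (((f ∘ suc) ⊛ g) ⊛ h) n)
    ≡⟨ cong (f 0 * g 0 * h (suc n) +_) (cong₂ _+_ (⊛-scaleˡ (f 0) (g ∘ suc) h n) (⊛-assoc′ (f ∘ suc) g h n)) ⟩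
  f 0 * g 0 * h (suc n) + (f 0 * ((g ∘ suc) ⊛ h) n + r)             ≡⟨ factor (f 0) (g 0) _ _ r ⟩
  f 0 * (g 0 * h (suc n) + ((g ∘ suc) ⊛ h) n) + r                   ≡⟨ cong (λ x → f 0 * x + r) (⊛-suc g h n) ⟨
  f 0 * (g ⊛ h) (suc n) + r                                         ≡⟨ ⊛-suc f (g ⊛ h) n ⟨
  (f ⊛ (g ⊛ h)) (suc n)                                             ∎
  where
  open ≡-Reasoning
  s : Series
  s i = f 0 * g (suc i)
  r = ((f ∘ suc) ⊛ (g ⊛ h)) n
  factor : ∀ a b c d e → a * b * c + (a * d + e) ≡ a * (b * c + d) + e
  factor = solve-∀

⊛-identityˡ′ : ∀ f n → (oneS ⊛ f) n ≡ f n
⊛-identityˡ′ f zero    = trans (⊛-zero oneS f) (ℤₚ.*-identityˡ _)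
⊛-identityˡ′ f (suc n) = begin
  (oneS ⊛ f) (suc n)                   ≡⟨ ⊛-suc oneS f n ⟩
  1ℤ * f (suc n) + (0S ⊛ f) n          ≡⟨ cong₂ _+_ (ℤₚ.*-identityˡ (f (suc n))) (trans (⊛-∑ 0S f n) (∑-0 (suc n) (λ i _ → refl))) ⟩
  f (suc n) + 0ℤ                       ≡⟨ ℤₚ.+-identityʳ _ ⟩
  f (suc n)                            ∎
  where open ≡-Reasoning

seriesRing : CommutativeRing _ _
seriesRing = record
  { Carrier = Series
  ; _≈_ = _≈_
  ; _+_ = _⊞_
  ; _*_ = _⊛_
  ; -_ = ⊟_
  ; 0# = 0S
  ; 1# = oneS
  ; isCommutativeRing = record
    { isRing = record
      { +-isAbelianGroup = record
        { isGroup = record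
          { isMonoid = record
            { isSemigroup = record
              { isMagma = record
                { isEquivalence = record
                  { refl = coeffs λ _ → refl
                  ; sym = λ p → coeffs λ n → sym (at p n)
                  ; trans = λ p q → coeffs λ n → trans (at p n) (at q n)
                  }
                ; ∙-cong = λ p q → coeffs λ n → cong₂ _+_ (at p n) (at q n)
                }
              ; assoc = λ f g h → coeffs λ n → ℤₚ.+-assoc (f n) _ _
              }
            ; identity = (λ f → coeffs λ n → ℤₚ.+-identityˡ _) , (λ f → coeffs λ n → ℤₚ.+-identityʳ _)
            }
          ; inverse = (λ f → coeffs λ n → ℤₚ.+-inverseˡ (f n)) , (λ f → coeffs λ n → ℤₚ.+-inverseʳ (f n))
          ; ⁻¹-cong = λ p → coeffs λ n → cong -_ (at p n)
          }
        ; comm = λ f g → coeffs λ n → ℤₚ.+-comm (f n) _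
        }
      ; *-cong = ⊛-cong
      ; *-assoc = λ f g h → coeffs (⊛-assoc′ f g h)
      ; *-identity = (λ f → coeffs (⊛-identityˡ′ f))
                   , (λ f → coeffs λ n → trans (⊛-comm′ f oneS n) (⊛-identityˡ′ f n))
      ; distrib = (λ h f g → coeffs λ n → trans (⊛-comm′ h (f ⊞ g) n)
                     (trans (⊛-distribʳ′ h f g n) (cong₂ _+_ (⊛-comm′ f h n) (⊛-comm′ g h n))))
                , (λ h f g → coeffs (⊛-distribʳ′ h f g))
      }
    ; *-comm = λ f g → coeffs (⊛-comm′ f g)
    }
  }

-- Monomials, 1 + c q^k and 1/(1 − c q^k)

module S = CommutativeRing seriesRing
module ≈-Reasoning = Relation.Binary.Reasoning.Setoid S.setoid

⊛-congˡ : ∀ f {g g′} → g ≈ g′ → f ⊛ g ≈ f ⊛ g′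
⊛-congˡ f {g} {g′} p = ⊛-cong {f} {f} {g} {g′} S.refl p

⊛-congʳ : ∀ g {f f′} → f ≈ f′ → f ⊛ g ≈ f′ ⊛ g
⊛-congʳ g {f} {f′} p = ⊛-cong {f} {f′} {g} {g} p S.refl

⊞-congˡ : ∀ f {g g′} → g ≈ g′ → f ⊞ g ≈ f ⊞ g′
⊞-congˡ f p = coeffs λ n → cong (f n +_) (at p n)

const-⊛ : ∀ c f n → (const c ⊛ f) n ≡ c * f n
const-⊛ c f zero    = ⊛-zero (const c) f
const-⊛ c f (suc n) = begin
  (const c ⊛ f) (suc n)            ≡⟨ ⊛-suc (const c) f n ⟩
  c * f (suc n) + (0S ⊛ f) n       ≡⟨ cong (c * f (suc n) +_) (at (S.zeroˡ f) n) ⟩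
  c * f (suc n) + 0ℤ               ≡⟨ ℤₚ.+-identityʳ _ ⟩
  c * f (suc n)                    ∎
  where open ≡-Reasoning

-- Gives the ring solver integer coefficients that it can evaluate. Its constants are of the form
-- `const c`, so `oneS` has to be exchanged for `const 1ℤ` before the solver is called.
const-homomorphism : CommutativeRing.rawRing ℤₚ.+-*-commutativeRing
                       -Raw-AlmostCommutative⟶ fromCommutativeRing seriesRing
const-homomorphism = record
  { ⟦_⟧    = const
  ; +-homo = λ _ _ → coeffs λ { zero → refl ; (suc _) → refl }
  ; *-homo = λ a b → coeffs λ { zero → sym (const-⊛ a (const b) 0)
                              ; (suc n) → sym (trans (const-⊛ a (const b) (suc n)) (ℤₚ.*-zeroʳ a)) }
  ; -‿homo = λ _ → coeffs λ { zero → refl ; (suc _) → refl }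
  ; 0-homo = coeffs λ { zero → refl ; (suc _) → refl }
  ; 1-homo = coeffs λ { zero → refl ; (suc _) → refl }
  }

coeff≟ : ∀ a b → Maybe (const a ≈ const b)
coeff≟ a b with a ℤ.≟ b
... | yes refl = just S.refl
... | no _     = nothing

module Solver = Algebra.Solver.Ring (CommutativeRing.rawRing ℤₚ.+-*-commutativeRing)
  (fromCommutativeRing seriesRing) const-homomorphism coeff≟
open Solver using (solve; _:=_; _:+_; _:*_; _:-_; :-_; con)

X : ℕ → Series
X zero    = oneS
X (suc k) = qS (X k)

qS-⊛ : ∀ f g → qS f ⊛ g ≈ qS (f ⊛ g)
qS-⊛ f g = coeffs λ
  { zero    → ⊛-zero (qS f) g
  ; (suc n) → trans (⊛-suc (qS f) g n) (ℤₚ.+-identityˡ _) }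

qS-cong : ∀ {f g} → f ≈ g → qS f ≈ qS g
qS-cong p = coeffs λ { zero → refl ; (suc n) → at p n }

X-suc : ∀ k → X (suc k) ≈ X 1 ⊛ X k
X-suc k = S.sym (S.trans (qS-⊛ oneS (X k)) (qS-cong (S.*-identityˡ (X k))))

qS-X : ∀ f → qS f ≈ X 1 ⊛ f
qS-X f = S.sym (S.trans (qS-⊛ oneS f) (qS-cong (S.*-identityˡ f)))

X-+ : ∀ a b → X (a ℕ.+ b) ≈ X a ⊛ X b
X-+ zero    b = S.sym (S.*-identityˡ (X b))
X-+ (suc a) b = S.trans (qS-cong (X-+ a b)) (S.sym (qS-⊛ (X a) (X b)))

X-⊛-+ : ∀ k f n → (X k ⊛ f) (k ℕ.+ n) ≡ f n
X-⊛-+ zero    f n = at (S.*-identityˡ f) n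
X-⊛-+ (suc k) f n = trans (at (qS-⊛ (X k) f) (suc k ℕ.+ n)) (X-⊛-+ k f n)

X-⊛-< : ∀ k f n → n ℕ.< k → (X k ⊛ f) n ≡ 0ℤ
X-⊛-< (suc k) f zero    _         = at (qS-⊛ (X k) f) 0
X-⊛-< (suc k) f (suc n) (s≤s n<k) = trans (at (qS-⊛ (X k) f) (suc n)) (X-⊛-< k f n n<k)

X-at : ∀ c k n → c * X k n ≡ (if n ≡ᵇ k then c else 0ℤ)
X-at c zero    zero    = ℤₚ.*-identityʳ c
X-at c zero    (suc n) = ℤₚ.*-zeroʳ c
X-at c (suc k) zero    = ℤₚ.*-zeroʳ c
X-at c (suc k) (suc n) = X-at c k n

lin-X : ∀ c k → lin c k ≈ const 1ℤ ⊞ const c ⊛ X k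
lin-X c k = coeffs λ n → cong₂ _+_ (one n) (trans (sym (X-at c k n)) (sym (const-⊛ c (X k) n)))
  where
  one : ∀ n → (if n ≡ᵇ 0 then 1ℤ else 0ℤ) ≡ const 1ℤ n
  one zero    = refl
  one (suc n) = refl

oneS-const : oneS ≈ const 1ℤ
oneS-const = coeffs λ { zero → refl ; (suc _) → refl }

≢⇒≡ᵇ-false : ∀ {m n} → m ≢ n → (m ≡ᵇ n) ≡ false
≢⇒≡ᵇ-false {m} {n} m≢n with m ≡ᵇ n in eq
... | false = refl
... | true  = contradiction (ℕₚ.≡ᵇ⇒≡ m n (subst T (sym eq) tt)) m≢n

≡ᵇ-refl : ∀ n → (n ≡ᵇ n) ≡ true
≡ᵇ-refl zero    = refl
≡ᵇ-refl (suc n) = ≡ᵇ-refl n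

≡ᵇ-cancelˡ : ∀ k m n → (k ℕ.+ m ≡ᵇ k ℕ.+ n) ≡ (m ≡ᵇ n)
≡ᵇ-cancelˡ zero    m n = refl
≡ᵇ-cancelˡ (suc k) m n = ≡ᵇ-cancelˡ k m n

geomTerm : ℤ → ℕ → ℕ → ℕ → ℤ
geomTerm c k n m = if k ℕ.* m ≡ᵇ n then c ℤ.^ m else 0ℤ

geom-∑ : ∀ c k n → geom c k n ≡ ∑ (suc n) (geomTerm c k n)
geom-∑ c k n = sumℤ-map-upTo (suc n) (geomTerm c k n)

geomTerm-≢ : ∀ c k n m → k ℕ.* m ≢ n → geomTerm c k n m ≡ 0ℤ
geomTerm-≢ c k n m k*m≢n rewrite ≢⇒≡ᵇ-false k*m≢n = refl

geomTerm-suc : ∀ c k n m → geomTerm c k (k ℕ.+ n) (suc m) ≡ c * geomTerm c k n m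
geomTerm-suc c k n m rewrite ℕₚ.*-suc k m | ≡ᵇ-cancelˡ k (k ℕ.* m) n with k ℕ.* m ≡ᵇ n
... | true  = refl
... | false = sym (ℤₚ.*-zeroʳ c)

geomTerm-zero : ∀ c k n → geomTerm c k n 0 ≡ oneS n
geomTerm-zero c k n rewrite ℕₚ.*-zeroʳ k with n
... | zero  = refl
... | suc _ = refl

-- Replaces the explicit sum by the equation g = 1 + c q^k g, obtained by lowering the summation
-- index by one; `lin-geom` is this equation rearranged.
geom-unfold : ∀ c k → geom c (suc k) ≈ const 1ℤ ⊞ const c ⊛ (X (suc k) ⊛ geom c (suc k))
geom-unfold c k′ = coeffs λ n → begin
  g n                                                    ≡⟨ geom-∑ c k n ⟩
  geomTerm c k n 0 + ∑ n (geomTerm c k n ∘ suc)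
    ≡⟨ cong₂ _+_ (trans (geomTerm-zero c k n) (at oneS-const n)) (rest n) ⟩
  const 1ℤ n + c * (X k ⊛ g) n                           ≡⟨ cong (const 1ℤ n +_) (const-⊛ c (X k ⊛ g) n) ⟨
  const 1ℤ n + (const c ⊛ (X k ⊛ g)) n                   ∎
  where
  open ≡-Reasoning
  k = suc k′
  g = geom c k
  rest : ∀ n → ∑ n (geomTerm c k n ∘ suc) ≡ c * (X k ⊛ g) n
  rest n with n ℕ.<? k
  ... | yes n<k rewrite X-⊛-< k g n n<k | ℤₚ.*-zeroʳ c =
    ∑-0 n λ m _ → geomTerm-≢ c k n (suc m)
      (ℕₚ.>⇒≢ (ℕₚ.<-≤-trans n<k (ℕₚ.m≤m*n k (suc m))))
  ... | no n≮k = subst (λ n → ∑ n (geomTerm c k n ∘ suc) ≡ c * (X k ⊛ g) n)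
                   (ℕₚ.m+[n∸m]≡n (ℕₚ.≮⇒≥ n≮k)) (shifted (n ∸ k))
    where
    shifted : ∀ n → ∑ (k ℕ.+ n) (geomTerm c k (k ℕ.+ n) ∘ suc) ≡ c * (X k ⊛ g) (k ℕ.+ n)
    shifted n = begin
      ∑ (k ℕ.+ n) (geomTerm c k (k ℕ.+ n) ∘ suc)      ≡⟨ ∑-cong (k ℕ.+ n) (λ m _ → geomTerm-suc c k n m) ⟩
      ∑ (k ℕ.+ n) (λ m → c * geomTerm c k n m)        ≡⟨ ∑-*ˡ (k ℕ.+ n) c (geomTerm c k n) ⟩
      c * ∑ (k ℕ.+ n) (geomTerm c k n)
        -- The sum came from degree `k + n` and may run further than the one that defines `g n`. Its
        -- surplus indices satisfy m > n, hence k m > n as k is positive, and contribute zero.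
        ≡⟨ cong (c *_) (∑-truncate (s≤s (ℕₚ.m≤n+m n k′)) λ m n<m → geomTerm-≢ c k n m
             (ℕₚ.>⇒≢ (ℕₚ.<-≤-trans n<m (ℕₚ.m≤n*m m k)))) ⟩
      c * ∑ (suc n) (geomTerm c k n)                  ≡⟨ cong (c *_) (geom-∑ c k n) ⟨
      c * g n                                         ≡⟨ cong (c *_) (X-⊛-+ k g n) ⟨
      c * (X k ⊛ g) (k ℕ.+ n)                         ∎

lin-⊛ : ∀ c k f → lin c k ⊛ f ≈ f ⊞ const c ⊛ (X k ⊛ f)
lin-⊛ c k f = S.trans (S.*-congʳ (lin-X c k))
  (solve 3 (λ C x f → (con 1ℤ :+ C :* x) :* f := f :+ C :* (x :* f)) S.refl (const c) (X k) f)

const-neg : ∀ c → const (- c) ≈ ⊟ const c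
const-neg c = coeffs λ { zero → refl ; (suc _) → refl }

lin-geom : ∀ c k → lin (- c) (suc k) ⊛ geom c (suc k) ≈ oneS
lin-geom c k = begin
  lin (- c) (suc k) ⊛ g                                  ≈⟨ lin-⊛ (- c) (suc k) g ⟩
  g ⊞ const (- c) ⊛ (x ⊛ g)                              ≈⟨ S.+-cong (geom-unfold c k) (S.*-congʳ (const-neg c)) ⟩
  (const 1ℤ ⊞ const c ⊛ (x ⊛ g)) ⊞ (⊟ const c) ⊛ (x ⊛ g)
    ≈⟨ solve 2 (λ c y → (con 1ℤ :+ c :* y) :+ (:- c) :* y := con 1ℤ) S.refl (const c) (x ⊛ g) ⟩
  const 1ℤ                                               ≈⟨ oneS-const ⟨
  oneS                                                   ∎
  where
  open ≈-Reasoning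
  g = geom c (suc k)
  x = X (suc k)

-- Infinite products

-- Unlike `2 * n`, this computes to two successors at `suc n`, so raising a bound by an odd and then
-- an even part holds by definition.
dbl : ℕ → ℕ
dbl zero    = zero
dbl (suc n) = suc (suc (dbl n))

n≤dbl : ∀ n → n ℕ.≤ dbl n
n≤dbl zero    = z≤n
n≤dbl (suc n) = s≤s (ℕₚ.m≤n⇒m≤1+n (n≤dbl n))

dbl≡2* : ∀ n → dbl n ≡ 2 ℕ.* n
dbl≡2* zero    = refl
dbl≡2* (suc n) = cong suc (trans (cong suc (dbl≡2* n)) (sym (ℕₚ.+-suc n (n ℕ.+ 0))))

Π : ℕ → (ℕ → Series) → Series
Π zero    F = oneS
Π (suc k) F = F 0 ⊛ Π k (F ∘ suc)

finProd-Π : ∀ F k → finProd (map F (upTo k)) ≡ Π k F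
finProd-Π F k = trans (cong finProd (map-upTo F k)) (go F k)
  where
  go : ∀ F k → finProd (applyUpTo F k) ≡ Π k F
  go F zero    = refl
  go F (suc k) = cong (F 0 ⊛_) (go (F ∘ suc) k)

Π-cong : ∀ k {F G} → (∀ j → F j ≈ G j) → Π k F ≈ Π k G
Π-cong zero    e = S.refl
Π-cong (suc k) e = S.*-cong (e 0) (Π-cong k (e ∘ suc))

Π-last : ∀ k F → Π (suc k) F ≈ Π k F ⊛ F k
Π-last zero    F = S.*-comm (F 0) oneS
Π-last (suc k) F = S.trans (⊛-congˡ (F 0) (Π-last k (F ∘ suc))) (S.sym (S.*-assoc (F 0) (Π k (F ∘ suc)) (F (suc k))))

Π-⊛ : ∀ k F G → Π k (λ j → F j ⊛ G j) ≈ Π k F ⊛ Π k G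
Π-⊛ zero    F G = S.sym (S.*-identityˡ oneS)
Π-⊛ (suc k) F G = S.trans (⊛-congˡ (F 0 ⊛ G 0) (Π-⊛ k (F ∘ suc) (G ∘ suc)))
  (solve 4 (λ a b c d → (a :* b) :* (c :* d) := (a :* c) :* (b :* d)) S.refl
    (F 0) (G 0) (Π k (F ∘ suc)) (Π k (G ∘ suc)))

Π-dbl : ∀ k F → Π (dbl k) F ≈ Π k (F ∘ dbl) ⊛ Π k (F ∘ suc ∘ dbl)
Π-dbl zero    F = S.sym (S.*-identityˡ oneS)
Π-dbl (suc k) F = S.trans (⊛-congˡ (F 0) (⊛-congˡ (F 1) (Π-dbl k (F ∘ suc ∘ suc))))
  (solve 4 (λ a b c d → a :* (b :* (c :* d)) := (a :* c) :* (b :* d)) S.refl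
    (F 0) (F 1) (Π k (F ∘ suc ∘ suc ∘ dbl)) (Π k (F ∘ suc ∘ suc ∘ suc ∘ dbl)))

-- The condition under which infProd F is a genuine limit.
Convergent : (ℕ → Series) → Set
Convergent F = ∀ j i → i ℕ.≤ j → F j i ≡ oneS i

Convergent-suc : ∀ {F} → Convergent F → Convergent (F ∘ suc)
Convergent-suc t j i i≤j = t (suc j) i (ℕₚ.m≤n⇒m≤1+n i≤j)

Convergent-⊛ : ∀ {F G} → Convergent F → Convergent G → Convergent (λ j → F j ⊛ G j)
Convergent-⊛ {F} {G} s t j i i≤j = trans
  (⊛-cong-≤ {F j} {oneS} {G j} {oneS} i (λ l l≤i → s j l (ℕₚ.≤-trans l≤i i≤j)) (λ l l≤i → t j l (ℕₚ.≤-trans l≤i i≤j)))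
  (at (S.*-identityˡ oneS) i)

-- The factor of index k agrees with 1 up to degree k, so appending it changes no coefficient of
-- degree at most n < k.
Π-stable : ∀ {F} → Convergent F → ∀ n k → n ℕ.< k → ∀ i → i ℕ.≤ n → Π k F i ≡ Π (suc n) F i
Π-stable {F} t n (suc k) (s≤s n≤k) i i≤n with ℕₚ.m≤n⇒m<n∨m≡n n≤k
... | inj₂ refl = refl
... | inj₁ n<k  = begin
  Π (suc k) F i        ≡⟨ at (Π-last k F) i ⟩
  (Π k F ⊛ F k) i
    ≡⟨ ⊛-cong-≤ {Π k F} {Π k F} {F k} {oneS} i (λ _ _ → refl)
         (λ l l≤i → t k l (ℕₚ.≤-trans l≤i (ℕₚ.≤-trans i≤n n≤k))) ⟩
  (Π k F ⊛ oneS) i     ≡⟨ at (S.*-identityʳ (Π k F)) i ⟩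
  Π k F i              ≡⟨ Π-stable t n k n<k i i≤n ⟩
  Π (suc n) F i        ∎
  where open ≡-Reasoning

-- `infProd` uses a different number of factors for each coefficient. Here all coefficients below
-- `k` are read from the same finite product, to which finite identities apply.
infProd-Π : ∀ {F} → Convergent F → ∀ k i → i ℕ.< k → infProd F i ≡ Π k F i
infProd-Π {F} t k i i<k =
  trans (cong (λ P → P i) (finProd-Π F (suc i))) (sym (Π-stable t i k i<k i ℕₚ.≤-refl))

infProd-cong : ∀ {F G} → (∀ j → F j ≈ G j) → infProd F ≈ infProd G
infProd-cong {F} {G} e = coeffs λ n → begin
  infProd F n      ≡⟨ cong (λ P → P n) (finProd-Π F (suc n)) ⟩
  Π (suc n) F n    ≡⟨ at (Π-cong (suc n) e) n ⟩
  Π (suc n) G n    ≡⟨ cong (λ P → P n) (finProd-Π G (suc n)) ⟨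
  infProd G n      ∎
  where open ≡-Reasoning

infProd-split : ∀ {F} → Convergent F → infProd F ≈ F 0 ⊛ infProd (F ∘ suc)
infProd-split {F} t = coeffs λ n → trans (infProd-Π t (suc (suc n)) n (s≤s (ℕₚ.n≤1+n n)))
  (⊛-cong-≤ {F 0} {F 0} n (λ _ _ → refl)
    (λ i i≤n → sym (infProd-Π (Convergent-suc t) (suc n) i (s≤s i≤n))))

infProd-⊛ : ∀ {F G} → Convergent F → Convergent G → infProd (λ j → F j ⊛ G j) ≈ infProd F ⊛ infProd G
infProd-⊛ {F} {G} s t = coeffs λ n → begin
  infProd (λ j → F j ⊛ G j) n           ≡⟨ infProd-Π (Convergent-⊛ s t) (suc n) n ℕₚ.≤-refl ⟩
  Π (suc n) (λ j → F j ⊛ G j) n         ≡⟨ at (Π-⊛ (suc n) F G) n ⟩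
  (Π (suc n) F ⊛ Π (suc n) G) n
    ≡⟨ ⊛-cong-≤ {Π (suc n) F} {infProd F} {Π (suc n) G} {infProd G} n
         (λ i i≤n → sym (infProd-Π s (suc n) i (s≤s i≤n))) (λ i i≤n → sym (infProd-Π t (suc n) i (s≤s i≤n))) ⟩
  (infProd F ⊛ infProd G) n             ∎
  where open ≡-Reasoning

-- Cutting after an even number of factors leaves equally many of even and odd index; both
-- subproducts stay convergent because their indices only grow.
infProd-dbl : ∀ {F} → Convergent F → infProd F ≈ infProd (F ∘ dbl) ⊛ infProd (F ∘ suc ∘ dbl)
infProd-dbl {F} t = coeffs λ n → begin
  infProd F n            ≡⟨ infProd-Π t (dbl (suc n)) n (n≤dbl (suc n)) ⟩
  Π (dbl (suc n)) F n    ≡⟨ at (Π-dbl (suc n) F) n ⟩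
  (Π (suc n) (F ∘ dbl) ⊛ Π (suc n) (F ∘ suc ∘ dbl)) n
    ≡⟨ ⊛-cong-≤ {Π (suc n) (F ∘ dbl)} {infProd (F ∘ dbl)} {Π (suc n) (F ∘ suc ∘ dbl)} {infProd (F ∘ suc ∘ dbl)} n
         (λ i i≤n → sym (infProd-Π even (suc n) i (s≤s i≤n))) (λ i i≤n → sym (infProd-Π odd (suc n) i (s≤s i≤n))) ⟩
  (infProd (F ∘ dbl) ⊛ infProd (F ∘ suc ∘ dbl)) n    ∎
  where
  open ≡-Reasoning
  even : Convergent (F ∘ dbl)
  even j i i≤j = t (dbl j) i (ℕₚ.≤-trans i≤j (n≤dbl j))
  odd : Convergent (F ∘ suc ∘ dbl)
  odd j i i≤j = t (suc (dbl j)) i (ℕₚ.≤-trans i≤j (ℕₚ.m≤n⇒m≤1+n (n≤dbl j)))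

-- Convergence of q-products and the relations between them

lin-low : ∀ c k i → i ℕ.< k → lin c k i ≡ oneS i
lin-low c k i i<k rewrite ≢⇒≡ᵇ-false (ℕₚ.<⇒≢ i<k) with i
... | zero  = refl
... | suc _ = refl

geom-low : ∀ c k i → i ℕ.< k → geom c k i ≡ oneS i
geom-low c (suc k) i i<k = begin
  geom c (suc k) i                                          ≡⟨ at (geom-unfold c k) i ⟩
  const 1ℤ i + (const c ⊛ (X (suc k) ⊛ geom c (suc k))) i   ≡⟨ cong₂ _+_ (sym (at oneS-const i)) (const-⊛ c (X (suc k) ⊛ geom c (suc k)) i) ⟩
  oneS i + c * (X (suc k) ⊛ geom c (suc k)) i
    ≡⟨ cong (λ z → oneS i + c * z) (X-⊛-< (suc k) (geom c (suc k)) i i<k) ⟩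
  oneS i + c * 0ℤ                                           ≡⟨ cong (oneS i +_) (ℤₚ.*-zeroʳ c) ⟩
  oneS i + 0ℤ                                               ≡⟨ ℤₚ.+-identityʳ _ ⟩
  oneS i                                                    ∎
  where open ≡-Reasoning

index-bound : ∀ a d j i → i ℕ.≤ j → i ℕ.< suc a ℕ.+ suc d ℕ.* j
index-bound a d j i i≤j = s≤s (ℕₚ.≤-trans i≤j (ℕₚ.≤-trans (ℕₚ.m≤n*m j (suc d)) (ℕₚ.m≤n+m (suc d ℕ.* j) a)))

lin-convergent : ∀ σ a d → Convergent (λ j → lin σ (suc a ℕ.+ suc d ℕ.* j))
lin-convergent σ a d j i i≤j = lin-low σ _ i (index-bound a d j i i≤j)

geom-convergent : ∀ a d → Convergent (λ j → geom 1ℤ (suc a ℕ.+ suc d ℕ.* j))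
geom-convergent a d j i i≤j = geom-low 1ℤ _ i (index-bound a d j i i≤j)

≡⇒≈ : ∀ {f g} → f ≡ g → f ≈ g
≡⇒≈ refl = S.refl

index-suc : ∀ a d j → a ℕ.+ d ℕ.* suc j ≡ (d ℕ.+ a) ℕ.+ d ℕ.* j
index-suc a d j rewrite ℕₚ.*-suc d j | sym (ℕₚ.+-assoc a d (d ℕ.* j)) | ℕₚ.+-comm a d = refl

poch-split : ∀ σ a d → poch σ (suc a) (suc d) ≈ lin σ (suc a) ⊛ poch σ (suc d ℕ.+ suc a) (suc d)
poch-split σ a d = S.trans (infProd-split (lin-convergent σ a d))
  (S.*-cong (≡⇒≈ (cong (lin σ) (trans (cong (suc a ℕ.+_) (ℕₚ.*-zeroʳ d)) (ℕₚ.+-identityʳ (suc a)))))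
            (infProd-cong λ j → ≡⇒≈ (cong (lin σ) (index-suc (suc a) (suc d) j))))

invPoch-split : ∀ a d → invPochMinus (suc a) (suc d) ≈ geom 1ℤ (suc a) ⊛ invPochMinus (suc d ℕ.+ suc a) (suc d)
invPoch-split a d = S.trans (infProd-split (geom-convergent a d))
  (S.*-cong (≡⇒≈ (cong (geom 1ℤ) (trans (cong (suc a ℕ.+_) (ℕₚ.*-zeroʳ d)) (ℕₚ.+-identityʳ (suc a)))))
            (infProd-cong λ j → ≡⇒≈ (cong (geom 1ℤ) (index-suc (suc a) (suc d) j))))

poch-dissect : ∀ σ a → poch σ (suc a) 1 ≈ poch σ (suc a) 2 ⊛ poch σ (suc (suc a)) 2
poch-dissect σ a = S.trans (infProd-dbl (lin-convergent σ a 0))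
  (S.*-cong (infProd-cong λ j → ≡⇒≈ (cong (λ m → lin σ (suc a ℕ.+ m)) (trans (ℕₚ.*-identityˡ _) (dbl≡2* j))))
            (infProd-cong λ j → ≡⇒≈ (cong (lin σ) (trans (cong (λ m → suc a ℕ.+ m) (trans (ℕₚ.*-identityˡ _) (cong suc (dbl≡2* j))))
                                                          (ℕₚ.+-suc (suc a) (2 ℕ.* j))))))

lin-⊛-lin : ∀ k → lin 1ℤ k ⊛ lin (- 1ℤ) k ≈ lin (- 1ℤ) (k ℕ.+ k)
lin-⊛-lin k = begin
  lin 1ℤ k ⊛ lin (- 1ℤ) k                                        ≈⟨ S.*-cong (lin-X 1ℤ k) (lin-X (- 1ℤ) k) ⟩
  (const 1ℤ ⊞ const 1ℤ ⊛ X k) ⊛ (const 1ℤ ⊞ const (- 1ℤ) ⊛ X k)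
    ≈⟨ solve 1 (λ x → (con 1ℤ :+ con 1ℤ :* x) :* (con 1ℤ :+ con (- 1ℤ) :* x) := con 1ℤ :+ con (- 1ℤ) :* (x :* x)) S.refl (X k) ⟩
  const 1ℤ ⊞ const (- 1ℤ) ⊛ (X k ⊛ X k)                           ≈⟨ ⊞-congˡ (const 1ℤ) (⊛-congˡ (const (- 1ℤ)) (X-+ k k)) ⟨
  const 1ℤ ⊞ const (- 1ℤ) ⊛ X (k ℕ.+ k)                           ≈⟨ lin-X (- 1ℤ) (k ℕ.+ k) ⟨
  lin (- 1ℤ) (k ℕ.+ k)                                           ∎
  where open ≈-Reasoning

geom-⊛-lin : ∀ k → geom 1ℤ (suc k ℕ.+ suc k) ⊛ lin 1ℤ (suc k) ≈ geom 1ℤ (suc k)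
geom-⊛-lin k = begin
  G ⊛ L                 ≈⟨ S.*-identityʳ (G ⊛ L) ⟨
  (G ⊛ L) ⊛ oneS        ≈⟨ ⊛-congˡ (G ⊛ L) (lin-geom 1ℤ k) ⟨
  (G ⊛ L) ⊛ (L′ ⊛ g)    ≈⟨ solve 4 (λ a b c d → (a :* b) :* (c :* d) := ((b :* c) :* a) :* d) S.refl G L L′ g ⟩
  ((L ⊛ L′) ⊛ G) ⊛ g    ≈⟨ ⊛-congʳ g (⊛-congʳ G (lin-⊛-lin (suc k))) ⟩
  (lin (- 1ℤ) (suc k ℕ.+ suc k) ⊛ G) ⊛ g   ≈⟨ ⊛-congʳ g (lin-geom 1ℤ (k ℕ.+ suc k)) ⟩
  oneS ⊛ g              ≈⟨ S.*-identityˡ g ⟩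
  g                     ∎
  where
  open ≈-Reasoning
  G = geom 1ℤ (suc k ℕ.+ suc k)
  L = lin 1ℤ (suc k)
  L′ = lin (- 1ℤ) (suc k)
  g = geom 1ℤ (suc k)

-- Holds factor by factor: with b = `suc a`, the exponent 2b + 4j is twice b + 2j, so each factor is
-- (1+x)/(1-x²) = 1/(1-x).
invPoch-⊛-poch : ∀ a → invPochMinus (suc a ℕ.+ suc a) 4 ⊛ poch 1ℤ (suc a) 2 ≈ invPochMinus (suc a) 2
invPoch-⊛-poch a = S.trans
  (S.sym (infProd-⊛ (geom-convergent (a ℕ.+ suc a) 3) (lin-convergent 1ℤ a 1)))
  (infProd-cong λ j → S.trans (⊛-congʳ (lin 1ℤ (suc a ℕ.+ 2 ℕ.* j)) (≡⇒≈ (cong (geom 1ℤ) (index j)))) (geom-⊛-lin (a ℕ.+ 2 ℕ.* j)))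
  where
  index′ : ∀ b j → b ℕ.+ b ℕ.+ 4 ℕ.* j ≡ (b ℕ.+ 2 ℕ.* j) ℕ.+ (b ℕ.+ 2 ℕ.* j)
  index′ = ℕ-solve-∀
  index : ∀ j → suc a ℕ.+ suc a ℕ.+ 4 ℕ.* j ≡ (suc a ℕ.+ 2 ℕ.* j) ℕ.+ (suc a ℕ.+ 2 ℕ.* j)
  index = index′ (suc a)

-- Generating functions of partitions

private variable A : Set

sumBy : (A → ℤ) → List A → ℤ
sumBy v l = sumℤ (map v l)

sumBy-cong : ∀ {v v′ : A → ℤ} → v ≗ v′ → sumBy v ≗ sumBy v′
sumBy-cong e []      = refl
sumBy-cong e (x ∷ l) = cong₂ _+_ (e x) (sumBy-cong e l)

sumBy-++ : ∀ (v : A → ℤ) l k → sumBy v (l ++ k) ≡ sumBy v l + sumBy v k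
sumBy-++ v []      k = sym (ℤₚ.+-identityˡ _)
sumBy-++ v (x ∷ l) k = trans (cong (v x +_) (sumBy-++ v l k)) (sym (ℤₚ.+-assoc (v x) _ _))

sumBy-map : ∀ {B : Set} (v : B → ℤ) (f : A → B) l → sumBy v (map f l) ≡ sumBy (v ∘ f) l
sumBy-map v f l = cong sumℤ (sym (map-∘ l))

sumBy-concatMap : ∀ {B : Set} (v : B → ℤ) (f : A → List B) l →
                  sumBy v (concatMap f l) ≡ sumBy (sumBy v ∘ f) l
sumBy-concatMap v f []      = refl
sumBy-concatMap v f (x ∷ l) =
  trans (sumBy-++ v (f x) (concatMap f l)) (cong (sumBy v (f x) +_) (sumBy-concatMap v f l))

sumBy-*ˡ : ∀ c (v : A → ℤ) l → sumBy (λ x → c * v x) l ≡ c * sumBy v l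
sumBy-*ˡ c v []      = sym (ℤₚ.*-zeroʳ c)
sumBy-*ˡ c v (x ∷ l) = trans (cong (c * v x +_) (sumBy-*ˡ c v l)) (sym (ℤₚ.*-distribˡ-+ c (v x) _))

sumBy-*ʳ : ∀ c (v : A → ℤ) l → sumBy (λ x → v x * c) l ≡ sumBy v l * c
sumBy-*ʳ c v []      = refl
sumBy-*ʳ c v (x ∷ l) = trans (cong (v x * c +_) (sumBy-*ʳ c v l)) (sym (ℤₚ.*-distribʳ-+ c (v x) _))

sumBy-0 : ∀ {v : A → ℤ} → (∀ x → v x ≡ 0ℤ) → ∀ l → sumBy v l ≡ 0ℤ
sumBy-0 e []      = refl
sumBy-0 e (x ∷ l) = cong₂ _+_ (e x) (sumBy-0 e l)

sumBy-∑ : ∀ J (h : ℕ → A → ℤ) l → sumBy (λ x → ∑ J (λ j → h j x)) l ≡ ∑ J (λ j → sumBy (h j) l)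
sumBy-∑ J h []      = sym (∑-0 J (λ _ _ → refl))
sumBy-∑ J h (x ∷ l) = trans (cong (∑ J (λ j → h j x) +_) (sumBy-∑ J h l))
  (sym (∑-+ J (λ j → h j x) (λ j → sumBy (h j) l)))

sumBy-pts : ∀ v f n m → sumBy v (pts (suc f) (suc n) m)
            ≡ ∑ (m ⊓ suc n) (λ k → sumBy (v ∘ (suc k ∷_)) (pts f (n ∸ k) (suc k)))
sumBy-pts v f n m = begin
  sumBy v (pts (suc f) (suc n) m)            ≡⟨ sumBy-concatMap v first (map suc (upTo (m ⊓ suc n))) ⟩
  sumBy (sumBy v ∘ first) (map suc (upTo (m ⊓ suc n)))
    ≡⟨ sumBy-map (sumBy v ∘ first) suc (upTo (m ⊓ suc n)) ⟩
  sumBy (sumBy v ∘ first ∘ suc) (upTo (m ⊓ suc n))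
    ≡⟨ sumℤ-map-upTo (m ⊓ suc n) (sumBy v ∘ first ∘ suc) ⟩
  ∑ (m ⊓ suc n) (sumBy v ∘ first ∘ suc)
    ≡⟨ ∑-cong (m ⊓ suc n) (λ k _ → sumBy-map v (suc k ∷_) (pts f (n ∸ k) (suc k))) ⟩
  ∑ (m ⊓ suc n) (λ k → sumBy (v ∘ (suc k ∷_)) (pts f (n ∸ k) (suc k)))    ∎
  where
  open ≡-Reasoning
  first : ℕ → List (List ℕ)
  first k = map (k ∷_) (pts f (suc n ∸ k) k)

-- A recursive call of `pts` inherits more fuel than its size, whereas `gf` supplies exactly the
-- size; this reconciles the two.
sumBy-pts-fuel : ∀ v {f f′} n m → n ℕ.≤ f → n ℕ.≤ f′ → sumBy v (pts f n m) ≡ sumBy v (pts f′ n m)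
sumBy-pts-fuel v zero m _ _ = refl
sumBy-pts-fuel v {suc f} {suc f′} (suc n) m (s≤s n≤f) (s≤s n≤f′) = begin
  sumBy v (pts (suc f) (suc n) m)      ≡⟨ sumBy-pts v f n m ⟩
  ∑ (m ⊓ suc n) (λ k → sumBy (v ∘ (suc k ∷_)) (pts f (n ∸ k) (suc k)))
    ≡⟨ ∑-cong (m ⊓ suc n) (λ k _ → sumBy-pts-fuel (v ∘ (suc k ∷_)) (n ∸ k) (suc k)
         (ℕₚ.≤-trans (ℕₚ.m∸n≤m n k) n≤f) (ℕₚ.≤-trans (ℕₚ.m∸n≤m n k) n≤f′)) ⟩
  ∑ (m ⊓ suc n) (λ k → sumBy (v ∘ (suc k ∷_)) (pts f′ (n ∸ k) (suc k)))
                                       ≡⟨ sumBy-pts v f′ n m ⟨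
  sumBy v (pts (suc f′) (suc n) m)     ∎
  where open ≡-Reasoning

-- Records that the enumerated lists have no part above `m`. Weights with a distinctness condition
-- change predictably under a new part only on such lists.
sumBy-pts-cong : ∀ {v v′} f n m → (∀ l → All (ℕ._≤ m) l → v l ≡ v′ l) →
                 sumBy v (pts f n m) ≡ sumBy v′ (pts f n m)
sumBy-pts-cong f       zero    m e = cong (_+ 0ℤ) (e [] [])
sumBy-pts-cong zero    (suc n) m e = refl
sumBy-pts-cong {v} {v′} (suc f) (suc n) m e = begin
  sumBy v (pts (suc f) (suc n) m)      ≡⟨ sumBy-pts v f n m ⟩
  ∑ (m ⊓ suc n) (λ k → sumBy (v ∘ (suc k ∷_)) (pts f (n ∸ k) (suc k)))
    ≡⟨ ∑-cong (m ⊓ suc n) (λ k k< → sumBy-pts-cong f (n ∸ k) (suc k) λ l l≤ →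
         let k≤m = ℕₚ.≤-trans k< (ℕₚ.m⊓n≤m m (suc n)) in
         e (suc k ∷ l) (k≤m ∷ All.map (λ p≤ → ℕₚ.≤-trans p≤ k≤m) l≤)) ⟩
  ∑ (m ⊓ suc n) (λ k → sumBy (v′ ∘ (suc k ∷_)) (pts f (n ∸ k) (suc k)))
                                       ≡⟨ sumBy-pts v′ f n m ⟨
  sumBy v′ (pts (suc f) (suc n) m)     ∎
  where open ≡-Reasoning

-- Parts are bounded by `m`, and every further condition sits in the weight `v`. Removing the
-- largest part then gives another series of this kind, with `v` precomposed by `(m ∷_)`.
gf : (List ℕ → ℤ) → ℕ → Series
gf v m n = sumBy v (pts n n m)

gf-cong : ∀ {v v′} m → (∀ l → All (ℕ._≤ m) l → v l ≡ v′ l) → gf v m ≈ gf v′ m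
gf-cong m e = coeffs λ n → sumBy-pts-cong n n m e

gf-scale : ∀ c v m → gf (λ l → c * v l) m ≈ const c ⊛ gf v m
gf-scale c v m = coeffs λ n → trans (sumBy-*ˡ c v (pts n n m)) (sym (const-⊛ c (gf v m) n))

gf-zero : ∀ v → gf v 0 ≈ const (v [])
gf-zero v = coeffs λ { zero → ℤₚ.+-identityʳ _ ; (suc n) → sumBy-pts v n n 0 }

-- Splits by whether the largest part equals `suc m`. The remainder keeps the bound `suc m`, since
-- that part may recur.
gf-suc : ∀ v m → gf v (suc m) ≈ gf v m ⊞ X (suc m) ⊛ gf (v ∘ (suc m ∷_)) (suc m)
gf-suc v m = coeffs go
  where
  open ≡-Reasoning
  h = gf (v ∘ (suc m ∷_)) (suc m)
  go : ∀ n → gf v (suc m) n ≡ gf v m n + (X (suc m) ⊛ h) n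
  go zero = sym (trans (cong (gf v m 0 +_) (X-⊛-< (suc m) h 0 (s≤s z≤n))) (ℤₚ.+-identityʳ _))
  go (suc n) = begin
    gf v (suc m) (suc n)                      ≡⟨ sumBy-pts v n n (suc m) ⟩
    ∑ (suc m ⊓ suc n) term                    ≡⟨ split (n ℕ.<? m) ⟩
    ∑ (m ⊓ suc n) term + (X (suc m) ⊛ h) (suc n)
                                              ≡⟨ cong (_+ (X (suc m) ⊛ h) (suc n)) (sumBy-pts v n n m) ⟨
    gf v m (suc n) + (X (suc m) ⊛ h) (suc n)  ∎
    where
    term : ℕ → ℤ
    term k = sumBy (v ∘ (suc k ∷_)) (pts n (n ∸ k) (suc k))
    -- A part `suc m` fits into size `suc n` only if m ≤ n. Otherwise the minimum with `suc n` is
    -- the same for both bounds and the shifted series has no coefficient here.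
    split : Dec (n ℕ.< m) → ∑ (suc m ⊓ suc n) term ≡ ∑ (m ⊓ suc n) term + (X (suc m) ⊛ h) (suc n)
    split (yes n<m) = begin
      ∑ (suc m ⊓ suc n) term
        ≡⟨ cong (λ N → ∑ N term) (trans (ℕₚ.m≥n⇒m⊓n≡n (ℕₚ.m≤n⇒m≤1+n n<m)) (sym (ℕₚ.m≥n⇒m⊓n≡n n<m))) ⟩
      ∑ (m ⊓ suc n) term                            ≡⟨ ℤₚ.+-identityʳ _ ⟨
      ∑ (m ⊓ suc n) term + 0ℤ
        ≡⟨ cong (∑ (m ⊓ suc n) term +_) (X-⊛-< (suc m) h (suc n) (s≤s n<m)) ⟨
      ∑ (m ⊓ suc n) term + (X (suc m) ⊛ h) (suc n)  ∎
    split (no n≮m) = begin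
      ∑ (suc m ⊓ suc n) term    ≡⟨ cong (λ N → ∑ N term) (ℕₚ.m≤n⇒m⊓n≡m (s≤s m≤n)) ⟩
      ∑ (suc m) term            ≡⟨ ∑-last m term ⟩
      ∑ m term + term m
        ≡⟨ cong₂ _+_ (cong (λ N → ∑ N term) (sym (ℕₚ.m≤n⇒m⊓n≡m (ℕₚ.m≤n⇒m≤1+n m≤n)))) last ⟩
      ∑ (m ⊓ suc n) term + (X (suc m) ⊛ h) (suc n)  ∎
      where
      m≤n = ℕₚ.≮⇒≥ n≮m
      last : term m ≡ (X (suc m) ⊛ h) (suc n)
      last = begin
        term m                                ≡⟨ sumBy-pts-fuel (v ∘ (suc m ∷_)) (n ∸ m) (suc m) (ℕₚ.m∸n≤m n m) ℕₚ.≤-refl ⟩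
        h (n ∸ m)                             ≡⟨ X-⊛-+ (suc m) h (n ∸ m) ⟨
        (X (suc m) ⊛ h) (suc m ℕ.+ (n ∸ m))   ≡⟨ cong (X (suc m) ⊛ h) (cong suc (ℕₚ.m+[n∸m]≡n m≤n)) ⟩
        (X (suc m) ⊛ h) (suc n)               ∎

gf-stable : ∀ v m n → n ℕ.≤ m → gf v m n ≡ gf v n n
gf-stable v zero    zero z≤n = refl
gf-stable v (suc m) n n≤1+m with ℕₚ.m≤n⇒m<n∨m≡n n≤1+m
... | inj₂ refl      = refl
... | inj₁ (s≤s n≤m) = begin
  gf v (suc m) n                  ≡⟨ at (gf-suc v m) n ⟩
  gf v m n + (X (suc m) ⊛ gf (v ∘ (suc m ∷_)) (suc m)) n
                                  ≡⟨ cong (gf v m n +_) (X-⊛-< (suc m) (gf (v ∘ (suc m ∷_)) (suc m)) n (s≤s n≤m)) ⟩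
  gf v m n + 0ℤ                   ≡⟨ ℤₚ.+-identityʳ _ ⟩
  gf v m n                        ≡⟨ gf-stable v m n n≤m ⟩
  gf v n n                        ∎
  where open ≡-Reasoning

gf-skip : ∀ v m → (∀ l → v (suc m ∷ l) ≡ 0ℤ) → gf v (suc m) ≈ gf v m
gf-skip v m e = begin
  gf v (suc m)                                         ≈⟨ gf-suc v m ⟩
  gf v m ⊞ X (suc m) ⊛ gf (v ∘ (suc m ∷_)) (suc m)
    ≈⟨ ⊞-congˡ (gf v m) (⊛-congˡ (X (suc m)) (coeffs λ n → sumBy-0 e (pts n n (suc m)))) ⟩
  gf v m ⊞ X (suc m) ⊛ 0S                              ≈⟨ ⊞-congˡ (gf v m) (S.zeroʳ (X (suc m))) ⟩
  gf v m ⊞ 0S                                          ≈⟨ S.+-identityʳ (gf v m) ⟩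
  gf v m                                               ∎
  where open ≈-Reasoning

gf-const : ∀ v m → (∀ k l → k ℕ.< m → v (suc k ∷ l) ≡ 0ℤ) → gf v m ≈ const (v [])
gf-const v zero    e = gf-zero v
gf-const v (suc m) e = S.trans (gf-skip v m (λ l → e m l ℕₚ.≤-refl))
  (gf-const v m (λ k l k<m → e k l (ℕₚ.m≤n⇒m≤1+n k<m)))

divide : ∀ c k {f g} → lin (- c) (suc k) ⊛ f ≈ g → f ≈ geom c (suc k) ⊛ g
divide c k {f} {g} e = begin
  f                                                  ≈⟨ S.*-identityˡ f ⟨
  oneS ⊛ f                                           ≈⟨ ⊛-congʳ f (lin-geom c k) ⟨
  (lin (- c) (suc k) ⊛ geom c (suc k)) ⊛ f
    ≈⟨ solve 3 (λ a b c → (a :* b) :* c := b :* (a :* c)) S.refl (lin (- c) (suc k)) (geom c (suc k)) f ⟩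
  geom c (suc k) ⊛ (lin (- c) (suc k) ⊛ f)           ≈⟨ ⊛-congˡ (geom c (suc k)) e ⟩
  geom c (suc k) ⊛ g                                 ∎
  where open ≈-Reasoning

-- With a weight blind to the new part, `gf-suc` becomes G = g + q^{m+1} G, which is solved by
-- division.
gf-repeatable : ∀ v m → (∀ l → v (suc m ∷ l) ≡ v l) → gf v (suc m) ≈ geom 1ℤ (suc m) ⊛ gf v m
gf-repeatable v m e = divide 1ℤ m (begin
  lin (- 1ℤ) (suc m) ⊛ G                         ≈⟨ lin-⊛ (- 1ℤ) (suc m) G ⟩
  G ⊞ const (- 1ℤ) ⊛ (x ⊛ G)                     ≈⟨ S.+-congʳ {const (- 1ℤ) ⊛ (x ⊛ G)} unfold ⟩
  (gf v m ⊞ x ⊛ G) ⊞ const (- 1ℤ) ⊛ (x ⊛ G)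
    ≈⟨ solve 2 (λ a b → (a :+ b) :+ con (- 1ℤ) :* b := a) S.refl (gf v m) (x ⊛ G) ⟩
  gf v m                                         ∎)
  where
  open ≈-Reasoning
  G = gf v (suc m)
  x = X (suc m)
  unfold : G ≈ gf v m ⊞ x ⊛ G
  unfold = S.trans (gf-suc v m)
    (⊞-congˡ (gf v m) (⊛-congˡ x (gf-cong (suc m) (λ l _ → e l))))

-- As a second copy has weight zero, the remainder after one copy has parts at most `m`; this is why
-- the effect of a single copy need be known only on such lists.
gf-distinct : ∀ w v m → (∀ l → All (ℕ._≤ m) l → v (suc m ∷ l) ≡ w * v l) →
              (∀ l → v (suc m ∷ suc m ∷ l) ≡ 0ℤ) → gf v (suc m) ≈ lin w (suc m) ⊛ gf v m
gf-distinct w v m once twice = begin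
  gf v (suc m)                              ≈⟨ gf-suc v m ⟩
  gf v m ⊞ x ⊛ gf (v ∘ (suc m ∷_)) (suc m)  ≈⟨ ⊞-congˡ (gf v m) (⊛-congˡ x rest) ⟩
  gf v m ⊞ x ⊛ (const w ⊛ gf v m)
    ≈⟨ solve 3 (λ a b c → a :+ b :* (c :* a) := a :+ c :* (b :* a)) S.refl (gf v m) x (const w) ⟩
  gf v m ⊞ const w ⊛ (x ⊛ gf v m)           ≈⟨ lin-⊛ w (suc m) (gf v m) ⟨
  lin w (suc m) ⊛ gf v m                    ∎
  where
  open ≈-Reasoning
  x = X (suc m)
  rest : gf (v ∘ (suc m ∷_)) (suc m) ≈ const w ⊛ gf v m
  rest = S.trans (gf-skip (v ∘ (suc m ∷_)) m twice) (S.trans (gf-cong m once) (gf-scale w v m))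

-- All that is needed to turn the parts above 2a into a product: odd ones are free, even ones occur
-- at most once with weight `w`. Green and blue partitions differ only in the start `a` and in the
-- finite piece `gf v (dbl a)` below it.
record EvensDistinctAbove (w : ℤ) (v : List ℕ → ℤ) (a : ℕ) : Set where
  field
    odd   : ∀ i l → v (suc (dbl (i ℕ.+ a)) ∷ l) ≡ v l
    even  : ∀ i l → let m = suc (dbl (i ℕ.+ a)) in
            All (ℕ._≤ m) l → v (suc m ∷ l) ≡ w * v l
    twice : ∀ i l → let m = suc (dbl (i ℕ.+ a)) in v (suc m ∷ suc m ∷ l) ≡ 0ℤ

-- Unfolds to `sumBy v (partitions n)`.
total : (List ℕ → ℤ) → Series
total v n = gf v n n

module _ {w v a} (r : EvensDistinctAbove w v a) where
  open EvensDistinctAbove r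

  private
    oddFactor evenFactor : ℕ → Series
    oddFactor  i = geom 1ℤ (suc (dbl (i ℕ.+ a)))
    evenFactor i = lin w (suc (suc (dbl (i ℕ.+ a))))

    oddFactor-convergent : Convergent oddFactor
    oddFactor-convergent j i i≤j = geom-low 1ℤ _ i
      (s≤s (ℕₚ.≤-trans i≤j (ℕₚ.≤-trans (ℕₚ.m≤m+n j a) (n≤dbl (j ℕ.+ a)))))

    evenFactor-convergent : Convergent evenFactor
    evenFactor-convergent j i i≤j = lin-low w _ i
      (s≤s (ℕₚ.m≤n⇒m≤1+n (ℕₚ.≤-trans i≤j (ℕₚ.≤-trans (ℕₚ.m≤m+n j a) (n≤dbl (j ℕ.+ a))))))

    index : ∀ i → dbl (i ℕ.+ a) ≡ dbl a ℕ.+ 2 ℕ.* i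
    index zero    = sym (ℕₚ.+-identityʳ (dbl a))
    index (suc i) rewrite index i | ℕₚ.+-suc i (i ℕ.+ 0) | ℕₚ.+-suc (dbl a) (suc (i ℕ.+ (i ℕ.+ 0)))
      | ℕₚ.+-suc (dbl a) (i ℕ.+ (i ℕ.+ 0)) = refl

  gf-Π : ∀ k → gf v (dbl (k ℕ.+ a)) ≈ gf v (dbl a) ⊛ (Π k oddFactor ⊛ Π k evenFactor)
  gf-Π zero    = S.sym (S.trans (⊛-congˡ (gf v (dbl a)) (S.*-identityˡ oneS)) (S.*-identityʳ (gf v (dbl a))))
  gf-Π (suc k) = begin
    gf v (suc (suc m))                                    ≈⟨ gf-distinct w v (suc m) (even k) (twice k) ⟩
    evenFactor k ⊛ gf v (suc m)                           ≈⟨ ⊛-congˡ (evenFactor k) (gf-repeatable v m (odd k)) ⟩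
    evenFactor k ⊛ (oddFactor k ⊛ gf v m)                 ≈⟨ ⊛-congˡ (evenFactor k) (⊛-congˡ (oddFactor k) (gf-Π k)) ⟩
    evenFactor k ⊛ (oddFactor k ⊛ (gf v (dbl a) ⊛ (Π k oddFactor ⊛ Π k evenFactor)))
      ≈⟨ solve 5 (λ a b c d e → a :* (b :* (c :* (d :* e))) := c :* ((d :* b) :* (e :* a))) S.refl
           (evenFactor k) (oddFactor k) (gf v (dbl a)) (Π k oddFactor) (Π k evenFactor) ⟩
    gf v (dbl a) ⊛ ((Π k oddFactor ⊛ oddFactor k) ⊛ (Π k evenFactor ⊛ evenFactor k))
      ≈⟨ ⊛-congˡ (gf v (dbl a)) (⊛-cong (Π-last k oddFactor) (Π-last k evenFactor)) ⟨
    gf v (dbl a) ⊛ (Π (suc k) oddFactor ⊛ Π (suc k) evenFactor)    ∎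
    where
    open ≈-Reasoning
    m = dbl (k ℕ.+ a)

  total-infProd : total v ≈ gf v (dbl a) ⊛ (invPochMinus (suc (dbl a)) 2 ⊛ poch w (suc (suc (dbl a))) 2)
  total-infProd = S.trans (coeffs λ n → coefficient n)
    (⊛-congˡ (gf v (dbl a)) (⊛-cong
      (infProd-cong λ i → ≡⇒≈ (cong (λ m → geom 1ℤ (suc m)) (index i)))
      (infProd-cong λ i → ≡⇒≈ (cong (λ m → lin w (suc (suc m))) (index i)))))
    where
    open ≡-Reasoning
    coefficient : ∀ n → total v n ≡ (gf v (dbl a) ⊛ (infProd oddFactor ⊛ infProd evenFactor)) n
    coefficient n = begin
      -- This bound is at least n, so no partition of n is lost, and it contributes exactly `suc n`
      -- factors of each parity, enough for degree n.
      gf v n n                          ≡⟨ gf-stable v (dbl (suc n ℕ.+ a)) n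
                                             (ℕₚ.≤-trans (ℕₚ.≤-trans (ℕₚ.n≤1+n n) (ℕₚ.m≤m+n (suc n) a)) (n≤dbl (suc n ℕ.+ a))) ⟨
      gf v (dbl (suc n ℕ.+ a)) n        ≡⟨ at (gf-Π (suc n)) n ⟩
      (gf v (dbl a) ⊛ (Π (suc n) oddFactor ⊛ Π (suc n) evenFactor)) n
        ≡⟨ ⊛-cong-≤ {gf v (dbl a)} {gf v (dbl a)} n (λ _ _ → refl) (λ i i≤n →
             ⊛-cong-≤ {Π (suc n) oddFactor} {infProd oddFactor} {Π (suc n) evenFactor} {infProd evenFactor} i
               (λ l l≤i → sym (infProd-Π oddFactor-convergent (suc n) l (s≤s (ℕₚ.≤-trans l≤i i≤n))))
               (λ l l≤i → sym (infProd-Π evenFactor-convergent (suc n) l (s≤s (ℕₚ.≤-trans l≤i i≤n))))) ⟩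
      (gf v (dbl a) ⊛ (infProd oddFactor ⊛ infProd evenFactor)) n    ∎

-- Green and blue partitions

≤⇒≤ᵇ-true : ∀ {m n} → m ℕ.≤ n → (m ≤ᵇ n) ≡ true
≤⇒≤ᵇ-true {m} {n} m≤n with m ≤ᵇ n | ℕₚ.≤⇒≤ᵇ m≤n
... | true | _ = refl

<⇒≤ᵇ-false : ∀ {m n} → n ℕ.< m → (m ≤ᵇ n) ≡ false
<⇒≤ᵇ-false {m} {n} n<m with m ≤ᵇ n in eq
... | false = refl
... | true  = contradiction (ℕₚ.≤ᵇ⇒≤ m n (subst T (sym eq) tt)) (ℕₚ.<⇒≱ n<m)

isEven-dbl : ∀ n → isEven (dbl n) ≡ true
isEven-dbl zero    = refl
isEven-dbl (suc n) = isEven-dbl n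

isEven-suc-dbl : ∀ n → isEven (suc (dbl n)) ≡ false
isEven-suc-dbl zero    = refl
isEven-suc-dbl (suc n) = isEven-suc-dbl n

dbl-mono : ∀ {m n} → m ℕ.≤ n → dbl m ℕ.≤ dbl n
dbl-mono z≤n       = z≤n
dbl-mono (s≤s m≤n) = s≤s (s≤s (dbl-mono m≤n))

dbl-injective : ∀ {m n} → dbl m ≡ dbl n → m ≡ n
dbl-injective {zero}  {zero}  _ = refl
dbl-injective {suc m} {suc n} e = cong suc (dbl-injective (ℕₚ.suc-injective (ℕₚ.suc-injective e)))

parity : ∀ n → (∃ λ j → n ≡ dbl j) ⊎ (∃ λ j → n ≡ suc (dbl j))
parity zero    = inj₁ (0 , refl)
parity (suc n) with parity n
... | inj₁ (j , refl) = inj₂ (j , refl)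
... | inj₂ (j , refl) = inj₁ (suc j , refl)

-- Conditions on lists of parts

allB-cong : ∀ {P Q : A → Bool} {l} → All (λ x → P x ≡ Q x) l → allB P l ≡ allB Q l
allB-cong []       = refl
allB-cong (e ∷ es) = cong₂ _∧_ e (allB-cong es)

allB-++ : ∀ (P : A → Bool) l k → allB P (l ++ k) ≡ allB P l ∧ allB P k
allB-++ P []      k = refl
allB-++ P (x ∷ l) k rewrite allB-++ P l k = sym (∧-assoc (P x) (allB P l) (allB P k))

allB-reverse : ∀ (P : A → Bool) l → allB P (reverse l) ≡ allB P l
allB-reverse P []      = refl
allB-reverse P (x ∷ l) rewrite unfold-reverse x l | allB-++ P (reverse l) (x ∷ [])
  | allB-reverse P l | ∧-identityʳ (P x) = ∧-comm (allB P l) (P x)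

countB-++ : ∀ (P : A → Bool) l k → countB P (l ++ k) ≡ countB P l ℕ.+ countB P k
countB-++ P []      k = refl
countB-++ P (x ∷ l) k with P x
... | true  = cong suc (countB-++ P l k)
... | false = countB-++ P l k

countB-> : ∀ {x l} → All (ℕ._< x) l → countB (x ≡ᵇ_) l ≡ 0
countB-> []          = refl
countB-> (y<x ∷ l<x) rewrite ≢⇒≡ᵇ-false (ℕₚ.>⇒≢ y<x) = countB-> l<x

-- A new part `x` raises the multiplicity of `x` only, and being odd it is exempt from the test.
evensDistinct-odd : ∀ x l → isEven x ≡ false → evensDistinct (x ∷ l) ≡ evensDistinct l
evensDistinct-odd x l odd rewrite odd = allB-cong (All.universal agree l)
  where
  agree : ∀ p → not (isEven p) ∨ (countB (p ≡ᵇ_) (x ∷ l) ≤ᵇ 1) ≡ not (isEven p) ∨ (countB (p ≡ᵇ_) l ≤ᵇ 1)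
  agree p with p ≡ᵇ x in eq
  ... | false = refl
  ... | true with ℕₚ.≡ᵇ⇒≡ p x (subst T (sym eq) tt)
  ...   | refl rewrite odd = refl

evensDistinct-> : ∀ x l → All (ℕ._< x) l → evensDistinct (x ∷ l) ≡ evensDistinct l
evensDistinct-> x l l<x rewrite ≡ᵇ-refl x | countB-> l<x | ∨-zeroʳ (not (isEven x)) =
  allB-cong (All.map agree l<x)
  where
  agree : ∀ {p} → p ℕ.< x → not (isEven p) ∨ (countB (p ≡ᵇ_) (x ∷ l) ≤ᵇ 1) ≡ not (isEven p) ∨ (countB (p ≡ᵇ_) l ≤ᵇ 1)
  agree p<x rewrite ≢⇒≡ᵇ-false (ℕₚ.<⇒≢ p<x) = refl
evensDistinct-twice : ∀ x l → isEven x ≡ true → evensDistinct (x ∷ x ∷ l) ≡ false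
evensDistinct-twice x l even rewrite ≡ᵇ-refl x | even = refl

allowedAbove : ℕ → ℕ → Bool
allowedAbove s p = if isEven p then suc (suc (suc (suc s))) ≤ᵇ p else suc (suc s) ≤ᵇ p

-- The blue conditions of `isB` on sizes, with the smallest part `s` prescribed. Reading from the
-- largest part, instead of reversing the list, matches the recursion of `gf`.
blueShape : ℕ → List ℕ → Bool
blueShape s []          = false
blueShape s (x ∷ [])    = x ≡ᵇ s
blueShape s (x ∷ y ∷ l) = allowedAbove s x ∧ blueShape s (y ∷ l)

blueShape-∷ : ∀ {s x} l → x ≢ s → blueShape s (x ∷ l) ≡ allowedAbove s x ∧ blueShape s l
blueShape-∷ {s} {x} []      x≢s = trans (≢⇒≡ᵇ-false x≢s) (sym (∧-zeroʳ (allowedAbove s x)))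
blueShape-∷         (y ∷ l) x≢s = refl

blueShape-∷ʳ : ∀ s l t → blueShape s (l ∷ʳ t) ≡ allB (allowedAbove s) l ∧ (t ≡ᵇ s)
blueShape-∷ʳ s []          t = refl
blueShape-∷ʳ s (x ∷ [])    t = cong (_∧ (t ≡ᵇ s)) (sym (∧-identityʳ (allowedAbove s x)))
blueShape-∷ʳ s (x ∷ y ∷ l) t = trans (cong (allowedAbove s x ∧_) (blueShape-∷ʳ s (y ∷ l) t))
  (sym (∧-assoc (allowedAbove s x) (allB (allowedAbove s) (y ∷ l)) (t ≡ᵇ s)))

allowedAbove-even : ∀ s p → isEven p ≡ true → allowedAbove s p ≡ (suc (suc (suc (suc s))) ≤ᵇ p)
allowedAbove-even s p e rewrite e = refl

allowedAbove-odd : ∀ s p → isEven p ≡ false → allowedAbove s p ≡ (suc (suc s) ≤ᵇ p)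
allowedAbove-odd s p e rewrite e = refl

allowedAbove-small : ∀ s p → p ℕ.< suc (suc s) → allowedAbove s p ≡ false
allowedAbove-small s p p<s+2 with isEven p
... | true  = <⇒≤ᵇ-false (ℕₚ.m≤n⇒m≤1+n (ℕₚ.m≤n⇒m≤1+n p<s+2))
... | false = <⇒≤ᵇ-false p<s+2

allowedAbove-large : ∀ s p → suc (suc (suc (suc s))) ℕ.≤ p → allowedAbove s p ≡ true
allowedAbove-large s p s+4≤p with isEven p
... | true  = ≤⇒≤ᵇ-true s+4≤p
... | false = ≤⇒≤ᵇ-true (ℕₚ.≤-trans (ℕₚ.m≤n⇒m≤1+n (ℕₚ.n≤1+n _)) s+4≤p)

blueShape-allowed : ∀ {s x} l → x ≢ s → allowedAbove s x ≡ true → blueShape s (x ∷ l) ≡ blueShape s l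
blueShape-allowed {s} l x≢s e = trans (blueShape-∷ l x≢s) (cong (_∧ blueShape s l) e)

module Weights (w : ℤ) where

  weight : (List ℕ → Bool) → List ℕ → ℤ
  weight C l = if C l ∧ evensDistinct l then w ℤ.^ countB isEven l else 0ℤ

  weight-reject : ∀ C l → C l ≡ false → weight C l ≡ 0ℤ
  weight-reject C l e rewrite e = refl

  weight-odd : ∀ C x l → isEven x ≡ false → C (x ∷ l) ≡ C l → weight C (x ∷ l) ≡ weight C l
  weight-odd C x l odd e rewrite e | evensDistinct-odd x l odd | odd = refl

  weight-even : ∀ C x l → isEven x ≡ true → C (x ∷ l) ≡ C l → All (ℕ._< x) l → weight C (x ∷ l) ≡ w * weight C l
  weight-even C x l even e l<x rewrite e | evensDistinct-> x l l<x | even with C l ∧ evensDistinct l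
  ... | true  = refl
  ... | false = sym (ℤₚ.*-zeroʳ w)

  weight-twice : ∀ C x l → isEven x ≡ true → weight C (x ∷ x ∷ l) ≡ 0ℤ
  weight-twice C x l even rewrite evensDistinct-twice x l even | ∧-zeroʳ (C (x ∷ x ∷ l)) = refl

  weight-distinct : ∀ C a → (∀ x l → dbl a ℕ.< x → C (x ∷ l) ≡ C l) → EvensDistinctAbove w (weight C) a
  weight-distinct C a e = record
    { odd   = λ i l → weight-odd C _ l (isEven-suc-dbl (i ℕ.+ a)) (e _ l (above i))
    ; even  = λ i l l≤ → weight-even C _ l (isEven-dbl (i ℕ.+ a)) (e _ l (ℕₚ.m≤n⇒m≤1+n (above i))) (All.map s≤s l≤)
    ; twice = λ i l → weight-twice C _ l (isEven-dbl (i ℕ.+ a))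
    }
    where
    above : ∀ i → dbl a ℕ.< suc (dbl (i ℕ.+ a))
    above i = s≤s (dbl-mono (ℕₚ.m≤n+m a i))

  green : ℕ → List ℕ → ℤ
  green s = weight (allB (s ≤ᵇ_))

  -- The bound is 2j, so below it only the empty partition survives and the finite piece is 1.
  green-total : ∀ j → total (green (suc (dbl j))) ≈ invPochMinus (suc (dbl j)) 2 ⊛ poch w (suc (suc (dbl j))) 2
  green-total j = begin
    total (green s)                                               ≈⟨ total-infProd distinct ⟩
    gf (green s) (dbl j) ⊛ (invPochMinus s 2 ⊛ poch w (suc s) 2)  ≈⟨ ⊛-congʳ P (gf-const (green s) (dbl j) small) ⟩
    const 1ℤ ⊛ (invPochMinus s 2 ⊛ poch w (suc s) 2)              ≈⟨ ⊛-congʳ P oneS-const ⟨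
    oneS ⊛ (invPochMinus s 2 ⊛ poch w (suc s) 2)                  ≈⟨ S.*-identityˡ P ⟩
    invPochMinus s 2 ⊛ poch w (suc s) 2                           ∎
    where
    open ≈-Reasoning
    s = suc (dbl j)
    P = invPochMinus s 2 ⊛ poch w (suc s) 2
    distinct : EvensDistinctAbove w (green s) j
    distinct = weight-distinct _ j λ x l s≤x → cong (_∧ allB (s ≤ᵇ_) l) (≤⇒≤ᵇ-true s≤x)
    small : ∀ k l → k ℕ.< dbl j → green s (suc k ∷ l) ≡ 0ℤ
    small k l k<s = weight-reject (allB (s ≤ᵇ_)) (suc k ∷ l) (cong (_∧ allB (s ≤ᵇ_) l) (<⇒≤ᵇ-false (s≤s k<s)))

  blue : ℕ → List ℕ → ℤ
  blue s = weight (blueShape s)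

  blue-reject : ∀ {s x} l → x ≢ s → allowedAbove s x ≡ false → blue s (x ∷ l) ≡ 0ℤ
  blue-reject {s} {x} l x≢s e =
    weight-reject (blueShape s) (x ∷ l) (trans (blueShape-∷ l x≢s) (cong (_∧ blueShape s l) e))

  -- The part s is not allowed above itself, so it occurs exactly once, at the end, and gives q^s;
  -- s+1 is even and too small; s+2 is odd and may repeat freely.
  blue-gf : ∀ j → let s = suc (dbl j) in gf (blue s) (suc (suc s)) ≈ geom 1ℤ (suc (suc s)) ⊛ X s
  blue-gf j = begin
    gf (blue s) (suc (suc s))                       ≈⟨ gf-repeatable (blue s) (suc s) step₂ ⟩
    g ⊛ gf (blue s) (suc s)                         ≈⟨ ⊛-congˡ g (gf-skip (blue s) s step₁) ⟩
    g ⊛ gf (blue s) s                               ≈⟨ ⊛-congˡ g (gf-suc (blue s) (dbl j)) ⟩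
    g ⊛ (gf (blue s) (dbl j) ⊞ X s ⊛ gf (blue s ∘ (s ∷_)) s)
      ≈⟨ ⊛-congˡ g (S.+-cong (gf-const (blue s) (dbl j) step₀)
           (⊛-congˡ (X s) (gf-const (blue s ∘ (s ∷_)) s tail₀))) ⟩
    g ⊛ (const 0ℤ ⊞ X s ⊛ const (blue s (s ∷ [])))  ≈⟨ ⊛-congˡ g (⊞-congˡ (const 0ℤ) (⊛-congˡ (X s) (≡⇒≈ (cong const alone)))) ⟩
    g ⊛ (const 0ℤ ⊞ X s ⊛ const 1ℤ)
      ≈⟨ ⊛-congˡ g (solve 1 (λ x → con 0ℤ :+ x :* con 1ℤ := x) S.refl (X s)) ⟩
    g ⊛ X s                                         ∎
    where
    open ≈-Reasoning
    s = suc (dbl j)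
    g = geom 1ℤ (suc (suc s))
    step₂ : ∀ l → blue s (suc (suc s) ∷ l) ≡ blue s l
    step₂ l = weight-odd (blueShape s) (suc (suc s)) l (isEven-suc-dbl j)
      (blueShape-allowed l (ℕₚ.>⇒≢ (s≤s (ℕₚ.n≤1+n s)))
        (trans (allowedAbove-odd s (suc (suc s)) (isEven-suc-dbl j)) (≤⇒≤ᵇ-true (ℕₚ.≤-refl {suc (suc s)}))))
    step₁ : ∀ l → blue s (suc s ∷ l) ≡ 0ℤ
    step₁ l = blue-reject l (ℕₚ.>⇒≢ (ℕₚ.≤-refl {suc s})) (allowedAbove-small s (suc s) ℕₚ.≤-refl)
    step₀ : ∀ k l → k ℕ.< dbl j → blue s (suc k ∷ l) ≡ 0ℤ
    step₀ k l k< = blue-reject l (ℕₚ.<⇒≢ (s≤s k<))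
      (allowedAbove-small s (suc k) (s≤s (ℕₚ.m≤n⇒m≤1+n (ℕₚ.m≤n⇒m≤1+n k<))))
    tail₀ : ∀ k l → k ℕ.< s → blue s (s ∷ suc k ∷ l) ≡ 0ℤ
    tail₀ k l k<s = weight-reject (blueShape s) (s ∷ suc k ∷ l)
      (cong (_∧ blueShape s (suc k ∷ l)) (allowedAbove-small s s (ℕₚ.n≤1+n (suc s))))
    alone : blue s (s ∷ []) ≡ 1ℤ
    alone rewrite evensDistinct-odd s [] (isEven-suc-dbl j) | ≡ᵇ-refl (dbl j) | isEven-suc-dbl j = refl

  -- The even number s+3 misses the bound s+4 and is skipped, so the regular pattern starts only at
  -- s+4 and the even product at s+5. The separate factor for s+2 then rejoins the odd product.
  blue-total : ∀ j → let s = suc (dbl j) in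
    total (blue s) ≈ X s ⊛ (invPochMinus (2 ℕ.+ s) 2 ⊛ poch w (5 ℕ.+ s) 2)
  blue-total j = begin
    total (blue s)                                      ≈⟨ total-infProd distinct ⟩
    gf (blue s) (3 ℕ.+ s) ⊛ (R ⊛ P)
      ≈⟨ ⊛-congʳ (R ⊛ P) (S.trans (gf-skip (blue s) (2 ℕ.+ s) step₃) (blue-gf j)) ⟩
    (geom 1ℤ (2 ℕ.+ s) ⊛ X s) ⊛ (R ⊛ P)
      ≈⟨ solve 4 (λ g x r p → (g :* x) :* (r :* p) := x :* ((g :* r) :* p)) S.refl (geom 1ℤ (2 ℕ.+ s)) (X s) R P ⟩
    X s ⊛ ((geom 1ℤ (2 ℕ.+ s) ⊛ R) ⊛ P)
      ≈⟨ ⊛-congˡ (X s) (⊛-congʳ P (invPoch-split (suc s) 1)) ⟨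
    X s ⊛ (invPochMinus (2 ℕ.+ s) 2 ⊛ P)                ∎
    where
    open ≈-Reasoning
    s = suc (dbl j)
    R = invPochMinus (4 ℕ.+ s) 2
    P = poch w (5 ℕ.+ s) 2
    step₃ : ∀ l → blue s (3 ℕ.+ s ∷ l) ≡ 0ℤ
    step₃ l = blue-reject l (ℕₚ.>⇒≢ (s≤s (ℕₚ.m≤n⇒m≤1+n (ℕₚ.n≤1+n s))))
      (trans (allowedAbove-even s (3 ℕ.+ s) (isEven-dbl j)) (<⇒≤ᵇ-false (ℕₚ.≤-refl {4 ℕ.+ s})))
    distinct : EvensDistinctAbove w (blue s) (2 ℕ.+ j)
    distinct = weight-distinct _ (2 ℕ.+ j) λ x l s+4≤x →
      blueShape-allowed l (ℕₚ.>⇒≢ (ℕₚ.≤-trans (s≤s (ℕₚ.m≤n+m s 3)) s+4≤x)) (allowedAbove-large s x s+4≤x)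

-- Telescoping

∑-swap : ∀ n J (h : ℕ → ℕ → ℤ) → ∑ n (λ m → ∑ J (h m)) ≡ ∑ J (λ j → ∑ n (λ m → h m j))
∑-swap zero    J h = sym (∑-0 J (λ _ _ → refl))
∑-swap (suc n) J h = trans (cong (∑ J (h 0) +_) (∑-swap n J (h ∘ suc)))
  (sym (∑-+ J (h 0) (λ j → ∑ n (λ m → h (suc m) j))))

∑-single : ∀ {J j h} → j ℕ.< J → (∀ i → i ≢ j → h i ≡ 0ℤ) → ∑ J h ≡ h j
∑-single {suc J} {zero} {h} _ e = trans (cong (h 0 +_) (∑-0 J (λ i _ → e (suc i) λ ()))) (ℤₚ.+-identityʳ _)
∑-single {suc J} {suc j} {h} (s≤s j<J) e = trans
  (cong₂ _+_ (e 0 λ ()) (∑-single j<J (λ i i≢j → e (suc i) (i≢j ∘ ℕₚ.suc-injective)))) (ℤₚ.+-identityˡ _)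

isB-∷ʳ : ∀ l t g → isB (l ∷ʳ t , g) ≡
  not (isEven t) ∧ allB (t ≤ᵇ_) g ∧ allB (allowedAbove t) l ∧ evensDistinct (l ∷ʳ t) ∧ evensDistinct g
isB-∷ʳ l t g rewrite reverse-++ l (t ∷ []) | allB-reverse (allowedAbove t) l = refl

-- Decomposition of two-color partitions by the smallest part

module TwoColorWeights (w : ℤ) where
  open Weights w

  signed : TwoColor → ℤ
  signed π = if isB π then w ℤ.^ numEven π else 0ℤ

  blue-end : ∀ s l t → t ≢ s → blue s (l ∷ʳ t) ≡ 0ℤ
  blue-end s l t t≢s = weight-reject (blueShape s) (l ∷ʳ t)
    (trans (blueShape-∷ʳ s l t) (trans (cong (allB (allowedAbove s) l ∧_) (≢⇒≡ᵇ-false t≢s)) (∧-zeroʳ _)))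

  -- Once the smallest blue part is fixed, the conditions on the two colors are independent and the
  -- number of even parts is additive, so the weight factors; this is what makes each `term` a
  -- product of two series.
  signed-odd : ∀ l t g → isEven t ≡ false → signed (l ∷ʳ t , g) ≡ blue t (l ∷ʳ t) * green t g
  signed-odd l t g odd
    rewrite isB-∷ʳ l t g | odd | blueShape-∷ʳ t l t | ≡ᵇ-refl t | ∧-identityʳ (allB (allowedAbove t) l)
          | countB-++ isEven (l ∷ʳ t) g
    with allB (t ≤ᵇ_) g | allB (allowedAbove t) l | evensDistinct (l ∷ʳ t) | evensDistinct g
  ... | true  | true  | true  | true  = ℤₚ.^-distribˡ-+-* w (countB isEven (l ∷ʳ t)) (countB isEven g)
  ... | true  | true  | true  | false = sym (ℤₚ.*-zeroʳ (w ℤ.^ countB isEven (l ∷ʳ t)))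
  ... | true  | true  | false | _     = refl
  ... | true  | false | _     | _     = refl
  ... | false | true  | true  | _     = sym (ℤₚ.*-zeroʳ (w ℤ.^ countB isEven (l ∷ʳ t)))
  ... | false | true  | false | _     = refl
  ... | false | false | _     | _     = refl

  signed-even : ∀ l t g → isEven t ≡ true → signed (l ∷ʳ t , g) ≡ 0ℤ
  signed-even l t g even rewrite isB-∷ʳ l t g | even = refl

  -- The sum has at most one nonzero term: s = 2j+1 must be the last blue part.
  signed-∑ : ∀ {n J} b g → All (ℕ._≤ n) b → n ℕ.< J →
    signed (b , g) ≡ ∑ J (λ j → blue (suc (dbl j)) b * green (suc (dbl j)) g)
  signed-∑ {n} {J} b g b≤n n<J with initLast b
  ... | []       = sym (∑-0 J λ _ _ → refl)
  ... | l ∷ʳ′ t with parity t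
  ...   | inj₁ (i , refl) = trans (signed-even l t g (isEven-dbl i))
    (sym (∑-0 J λ j _ → cong (_* green (suc (dbl j)) g) (blue-end (suc (dbl j)) l t (even≢odd i j))))
    where
    even≢odd : ∀ i j → dbl i ≢ suc (dbl j)
    even≢odd (suc i) (suc j) e = even≢odd i j (ℕₚ.suc-injective (ℕₚ.suc-injective e))
  ...   | inj₂ (i , refl) = trans (signed-odd l t g (isEven-suc-dbl i)) (sym (∑-single i<J λ j j≢i →
      cong (_* green (suc (dbl j)) g) (blue-end (suc (dbl j)) l t λ e → j≢i (sym (dbl-injective (ℕₚ.suc-injective e))))))
    where
    i<J : i ℕ.< J
    i<J = ℕₚ.≤-<-trans (ℕₚ.≤-trans (n≤dbl i) (ℕₚ.≤-trans (ℕₚ.n≤1+n (dbl i)) (All.head (Allₚ.++⁻ʳ l b≤n)))) n<J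

  term : ℕ → Series
  term j = total (blue (suc (dbl j))) ⊛ total (green (suc (dbl j)))

  genS : Series
  genS n = sumBy signed (twoColorPartitions n)

  -- A smallest part 2j+1 is at most n < J, so j < J. Leaving `J` free allows one partial sum to
  -- serve all degrees up to a given one.
  genS-∑ : ∀ n J → n ℕ.< J → genS n ≡ ∑ J (λ j → term j n)
  genS-∑ n J n<J = begin
    genS n                                            ≡⟨ sumBy-concatMap signed ofBlueSize (upTo (suc n)) ⟩
    sumBy (sumBy signed ∘ ofBlueSize) (upTo (suc n))  ≡⟨ sumℤ-map-upTo (suc n) (sumBy signed ∘ ofBlueSize) ⟩
    ∑ (suc n) (sumBy signed ∘ ofBlueSize)             ≡⟨ ∑-cong (suc n) (λ m m≤n → byBlueSize m (ℕₚ.<-≤-trans m≤n n<J)) ⟩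
    ∑ (suc n) (λ m → ∑ J (λ j → u j m * v j (n ∸ m)))  ≡⟨ ∑-swap (suc n) J (λ m j → u j m * v j (n ∸ m)) ⟩
    ∑ J (λ j → ∑ (suc n) (λ m → u j m * v j (n ∸ m)))  ≡⟨ ∑-cong J (λ j _ → sym (⊛-∑ (u j) (v j) n)) ⟩
    ∑ J (λ j → term j n)                              ∎
    where
    open ≡-Reasoning
    u v : ℕ → Series
    u j = total (blue (suc (dbl j)))
    v j = total (green (suc (dbl j)))
    ofBlueSize : ℕ → List TwoColor
    ofBlueSize m = concatMap (λ b → map (b ,_) (partitions (n ∸ m))) (partitions m)
    byBlueSize : ∀ m → m ℕ.< J → sumBy signed (ofBlueSize m) ≡ ∑ J (λ j → u j m * v j (n ∸ m))
    byBlueSize m m<J = begin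
      sumBy signed (ofBlueSize m)
        ≡⟨ sumBy-concatMap signed (λ b → map (b ,_) (partitions (n ∸ m))) (partitions m) ⟩
      sumBy (λ b → sumBy signed (map (b ,_) (partitions (n ∸ m)))) (partitions m)
        ≡⟨ sumBy-pts-cong m m m (λ b b≤m → byBlue b b≤m) ⟩
      sumBy (λ b → ∑ J (λ j → blue (suc (dbl j)) b * v j (n ∸ m))) (partitions m)
        ≡⟨ sumBy-∑ J (λ j b → blue (suc (dbl j)) b * v j (n ∸ m)) (partitions m) ⟩
      ∑ J (λ j → sumBy (λ b → blue (suc (dbl j)) b * v j (n ∸ m)) (partitions m))
        ≡⟨ ∑-cong J (λ j _ → sumBy-*ʳ (v j (n ∸ m)) (blue (suc (dbl j))) (partitions m)) ⟩
      ∑ J (λ j → u j m * v j (n ∸ m))    ∎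
      where
      byBlue : ∀ b → All (ℕ._≤ m) b → sumBy signed (map (b ,_) (partitions (n ∸ m)))
               ≡ ∑ J (λ j → blue (suc (dbl j)) b * v j (n ∸ m))
      byBlue b b≤m = begin
        sumBy signed (map (b ,_) (partitions (n ∸ m)))      ≡⟨ sumBy-map signed (b ,_) (partitions (n ∸ m)) ⟩
        sumBy (signed ∘ (b ,_)) (partitions (n ∸ m))
          ≡⟨ sumBy-cong (λ g → signed-∑ b g b≤m m<J) (partitions (n ∸ m)) ⟩
        sumBy (λ g → ∑ J (λ j → blue (suc (dbl j)) b * green (suc (dbl j)) g)) (partitions (n ∸ m))
          ≡⟨ sumBy-∑ J (λ j g → blue (suc (dbl j)) b * green (suc (dbl j)) g) (partitions (n ∸ m)) ⟩
        ∑ J (λ j → sumBy (λ g → blue (suc (dbl j)) b * green (suc (dbl j)) g) (partitions (n ∸ m)))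
          ≡⟨ ∑-cong J (λ j _ → sumBy-*ˡ (blue (suc (dbl j)) b) (green (suc (dbl j))) (partitions (n ∸ m))) ⟩
        ∑ J (λ j → blue (suc (dbl j)) b * v j (n ∸ m))    ∎

-- Series congruent to 1 modulo a power of q

Low : ℕ → Series → Set
Low k f = ∀ i → i ℕ.< k → f i ≡ oneS i

Low-⊛ : ∀ {k f g} → Low k f → Low k g → Low k (f ⊛ g)
Low-⊛ {f = f} {g} p q i i<k = trans
  (⊛-cong-≤ {f} {oneS} {g} {oneS} i (λ l l≤i → p l (ℕₚ.≤-<-trans l≤i i<k)) (λ l l≤i → q l (ℕₚ.≤-<-trans l≤i i<k)))
  (at (S.*-identityˡ oneS) i)

Low-Π : ∀ {k F} m → (∀ j → Low k (F j)) → Low k (Π m F)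
Low-Π zero    p i i<k = refl
Low-Π (suc m) p = Low-⊛ (p 0) (Low-Π m (p ∘ suc))

Low-infProd : ∀ {k F} → (∀ j → Low k (F j)) → Low k (infProd F)
Low-infProd {F = F} p i i<k = trans (cong (λ P → P i) (finProd-Π F (suc i))) (Low-Π (suc i) p i i<k)

Low-poch : ∀ {k} σ a d → k ℕ.≤ a → Low k (poch σ a d)
Low-poch σ a d k≤a = Low-infProd λ j i i<k → lin-low σ _ i (ℕₚ.<-≤-trans i<k (ℕₚ.≤-trans k≤a (ℕₚ.m≤m+n a (d ℕ.* j))))

Low-invPoch : ∀ {k} a d → k ℕ.≤ a → Low k (invPochMinus a d)
Low-invPoch a d k≤a = Low-infProd λ j i i<k → geom-low 1ℤ _ i (ℕₚ.<-≤-trans i<k (ℕₚ.≤-trans k≤a (ℕₚ.m≤m+n a (d ℕ.* j))))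

lin-X-+ : ∀ c k e → lin c (k ℕ.+ e) ≈ const 1ℤ ⊞ const c ⊛ (X k ⊛ X e)
lin-X-+ c k e = S.trans (lin-X c (k ℕ.+ e)) (⊞-congˡ (const 1ℤ) (⊛-congˡ (const c) (X-+ k e)))

X-2 : X 2 ≈ X 1 ⊛ X 1
X-2 = X-suc 1

X-3 : X 3 ≈ X 1 ⊛ (X 1 ⊛ X 1)
X-3 = S.trans (X-suc 2) (⊛-congˡ (X 1) X-2)

X-4 : X 4 ≈ X 1 ⊛ (X 1 ⊛ (X 1 ⊛ X 1))
X-4 = S.trans (X-suc 3) (⊛-congˡ (X 1) X-3)

linear : Series → Series → Series
linear c x = const 1ℤ ⊞ c ⊛ x

linear-cong : ∀ c {x y} → x ≈ y → linear c x ≈ linear c y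
linear-cong c p = ⊞-congˡ (const 1ℤ) (⊛-congˡ c p)

-- With a = q^{2j}, the right-hand side is w (U_j − U_{j+1}) divided by the products common to both.
telescoping-identity : ∀ W q a → W ⊛ W ≈ const 1ℤ →
  (linear W q ⊛ linear W (q ⊛ (q ⊛ q))) ⊛ a ≈
  W ⊛ ((linear W a ⊛ linear W ((q ⊛ (q ⊛ (q ⊛ q))) ⊛ a)) ⊞
       ⊟ (linear (const (- 1ℤ)) (q ⊛ a) ⊛ linear (const (- 1ℤ)) ((q ⊛ (q ⊛ q)) ⊛ a)))
telescoping-identity W q a W²≈1 = begin
  (linear W q ⊛ linear W (q ⊛ (q ⊛ q))) ⊛ a
    -- The solver treats `W` as an indeterminate, so the two sides differ by a multiple of 1 - W²;
    -- its cofactor a + W a² q⁴ is written out and then removed by the hypothesis.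
    ≈⟨ solve 3 (λ W q a →
         ((con 1ℤ :+ W :* q) :* (con 1ℤ :+ W :* (q :* (q :* q)))) :* a
         := W :* (((con 1ℤ :+ W :* a) :* (con 1ℤ :+ W :* ((q :* (q :* (q :* q))) :* a)))
                  :+ (:- ((con 1ℤ :+ con (- 1ℤ) :* (q :* a)) :* (con 1ℤ :+ con (- 1ℤ) :* ((q :* (q :* q)) :* a)))))
            :+ (con 1ℤ :+ (:- (W :* W))) :* (a :+ W :* (a :* (a :* (q :* (q :* (q :* q)))))))
         S.refl W q a ⟩
  Y ⊞ (const 1ℤ ⊞ ⊟ (W ⊛ W)) ⊛ K    ≈⟨ ⊞-congˡ Y (⊛-congʳ K (⊞-congˡ (const 1ℤ) (S.-‿cong W²≈1))) ⟩
  Y ⊞ (const 1ℤ ⊞ ⊟ const 1ℤ) ⊛ K   ≈⟨ solve 2 (λ y k → y :+ (con 1ℤ :+ (:- con 1ℤ)) :* k := y) S.refl Y K ⟩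
  Y                                 ∎
  where
  open ≈-Reasoning
  Y = W ⊛ ((linear W a ⊛ linear W ((q ⊛ (q ⊛ (q ⊛ q))) ⊛ a)) ⊞
           ⊟ (linear (const (- 1ℤ)) (q ⊛ a) ⊛ linear (const (- 1ℤ)) ((q ⊛ (q ⊛ q)) ⊛ a)))
  K = a ⊞ W ⊛ (a ⊛ (a ⊛ (q ⊛ (q ⊛ (q ⊛ q)))))

invPoch-shift : ∀ a → lin (- 1ℤ) (suc a) ⊛ invPochMinus (suc a) 2 ≈ invPochMinus (3 ℕ.+ a) 2
invPoch-shift a = begin
  l ⊛ invPochMinus (suc a) 2    ≈⟨ ⊛-congˡ l (invPoch-split a 1) ⟩
  l ⊛ (g ⊛ R)                   ≈⟨ S.*-assoc l g R ⟨
  (l ⊛ g) ⊛ R                   ≈⟨ ⊛-congʳ R (lin-geom 1ℤ a) ⟩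
  oneS ⊛ R                      ≈⟨ S.*-identityˡ R ⟩
  R                             ∎
  where
  open ≈-Reasoning
  l = lin (- 1ℤ) (suc a)
  g = geom 1ℤ (suc a)
  R = invPochMinus (3 ℕ.+ a) 2

module Telescope (w : ℤ) (w²≡1 : w * w ≡ 1ℤ) where
  open Weights w
  open TwoColorWeights w

  P : ℕ → Series
  P a = poch w a 2

  R : ℕ → Series
  R a = invPochMinus a 2

  -- The leading factor `lin w e` is kept apart because e = 0 at j = 0: there it is the constant 1 +
  -- w, and a product starting with it would not meet `Convergent`.
  U : ℕ → Series
  U j = (lin w e ⊛ P (2 ℕ.+ e)) ⊛ (P (4 ℕ.+ e) ⊛ (R (1 ℕ.+ e) ⊛ R (3 ℕ.+ e)))
    where e = dbl j

  M : Series
  M = lin w 1 ⊛ lin w 3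

  W²≈1 : const w ⊛ const w ≈ const 1ℤ
  W²≈1 = coeffs λ n → trans (const-⊛ w (const w) n) (go n)
    where
    go : ∀ n → w * const w n ≡ const 1ℤ n
    go zero    = w²≡1
    go (suc n) = ℤₚ.*-zeroʳ w

  module _ (j : ℕ) where
    private
      e = dbl j
      W = const w
      q = X 1
      a = X e
      N = const (- 1ℤ)
      P₂ = P (2 ℕ.+ e)
      P₆ = P (6 ℕ.+ e)
      R₁ = R (1 ℕ.+ e)
      R₃ = R (3 ℕ.+ e)

    term-product : term j ≈ (q ⊛ a) ⊛ ((R₃ ⊛ P₆) ⊛ (R₁ ⊛ P₂))
    term-product = begin
      term j                                            ≈⟨ S.*-cong (blue-total j) (green-total j) ⟩
      (X (suc e) ⊛ (R₃ ⊛ P₆)) ⊛ (R₁ ⊛ P₂)               ≈⟨ S.*-assoc (X (suc e)) (R₃ ⊛ P₆) (R₁ ⊛ P₂) ⟩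
      X (suc e) ⊛ ((R₃ ⊛ P₆) ⊛ (R₁ ⊛ P₂))               ≈⟨ ⊛-congʳ ((R₃ ⊛ P₆) ⊛ (R₁ ⊛ P₂)) (X-suc e) ⟩
      (q ⊛ a) ⊛ ((R₃ ⊛ P₆) ⊛ (R₁ ⊛ P₂))                 ∎
      where open ≈-Reasoning

    U-product : U j ≈ (linear W a ⊛ P₂) ⊛ ((linear W ((q ⊛ (q ⊛ (q ⊛ q))) ⊛ a) ⊛ P₆) ⊛ (R₁ ⊛ R₃))
    U-product = ⊛-cong (⊛-congʳ P₂ (lin-X w e))
      (⊛-congʳ (R₁ ⊛ R₃) (S.trans (poch-split w (3 ℕ.+ e) 1)
        (⊛-congʳ P₆ (S.trans (lin-X-+ w 4 e) (linear-cong W (⊛-congʳ a X-4))))))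

    -- Brought over the same four products as `term j`: the leading factor completes `P₂`, and each
    -- shortened denominator is the old one times the factor 1 - q^{e+1} or 1 - q^{e+3} that it
    -- lost.
    U-suc-product : U (suc j) ≈ P₂ ⊛ (P₆ ⊛ ((linear N (q ⊛ a) ⊛ R₁) ⊛ (linear N ((q ⊛ (q ⊛ q)) ⊛ a) ⊛ R₃)))
    U-suc-product = ⊛-cong (S.sym (poch-split w (1 ℕ.+ e) 1))
      (⊛-congˡ P₆ (⊛-cong
        (S.trans (S.sym (invPoch-shift e)) (⊛-congʳ R₁ (lin-X-+ (- 1ℤ) 1 e)))
        (S.trans (S.sym (invPoch-shift (2 ℕ.+ e)))
          (⊛-congʳ R₃ (S.trans (lin-X-+ (- 1ℤ) 3 e) (linear-cong N (⊛-congʳ a X-3)))))))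

    M-term : M ⊛ term j ≈ (W ⊛ q) ⊛ (U j ⊞ ⊟ U (suc j))
    M-term = begin
      M ⊛ term j
        ≈⟨ ⊛-cong (⊛-cong (lin-X w 1) (S.trans (lin-X w 3) (linear-cong W X-3))) term-product ⟩
      m ⊛ ((q ⊛ a) ⊛ ((R₃ ⊛ P₆) ⊛ (R₁ ⊛ P₂)))
        ≈⟨ solve 4 (λ m q a d → m :* ((q :* a) :* d) := (m :* a) :* (q :* d)) S.refl m q a ((R₃ ⊛ P₆) ⊛ (R₁ ⊛ P₂)) ⟩
      (m ⊛ a) ⊛ (q ⊛ ((R₃ ⊛ P₆) ⊛ (R₁ ⊛ P₂)))
        ≈⟨ ⊛-congʳ (q ⊛ ((R₃ ⊛ P₆) ⊛ (R₁ ⊛ P₂))) (telescoping-identity W q a W²≈1) ⟩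
      (W ⊛ ((α ⊛ β) ⊞ ⊟ (γ ⊛ δ))) ⊛ (q ⊛ ((R₃ ⊛ P₆) ⊛ (R₁ ⊛ P₂)))
        ≈⟨ solve 10 (λ W q α β γ δ P₂ P₆ R₁ R₃ →
             (W :* ((α :* β) :+ (:- (γ :* δ)))) :* (q :* ((R₃ :* P₆) :* (R₁ :* P₂)))
             := (W :* q) :* (((α :* P₂) :* ((β :* P₆) :* (R₁ :* R₃))) :+ (:- (P₂ :* (P₆ :* ((γ :* R₁) :* (δ :* R₃)))))))
             S.refl W q α β γ δ P₂ P₆ R₁ R₃ ⟩
      (W ⊛ q) ⊛ (((α ⊛ P₂) ⊛ ((β ⊛ P₆) ⊛ (R₁ ⊛ R₃))) ⊞ ⊟ (P₂ ⊛ (P₆ ⊛ ((γ ⊛ R₁) ⊛ (δ ⊛ R₃)))))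
        ≈⟨ ⊛-congˡ (W ⊛ q) (S.+-cong (S.sym U-product) (S.-‿cong (S.sym U-suc-product))) ⟩
      (W ⊛ q) ⊛ (U j ⊞ ⊟ U (suc j))    ∎
      where
      open ≈-Reasoning
      m = linear W q ⊛ linear W (q ⊛ (q ⊛ q))
      α = linear W a
      β = linear W ((q ⊛ (q ⊛ (q ⊛ q))) ⊛ a)
      γ = linear N (q ⊛ a)
      δ = linear N ((q ⊛ (q ⊛ q)) ⊛ a)

  partialSum : ℕ → Series
  partialSum zero    = 0S
  partialSum (suc J) = partialSum J ⊞ term J

  partialSum-∑ : ∀ J n → partialSum J n ≡ ∑ J (λ j → term j n)
  partialSum-∑ zero    n = refl
  partialSum-∑ (suc J) n = trans (cong (_+ term J n) (partialSum-∑ J n)) (sym (∑-last J (λ j → term j n)))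

  M-partialSum : ∀ J → M ⊛ partialSum J ≈ (const w ⊛ X 1) ⊛ (U 0 ⊞ ⊟ U J)
  M-partialSum zero = S.trans (S.zeroʳ M)
    (S.sym (S.trans (⊛-congˡ (const w ⊛ X 1) (S.-‿inverseʳ (U 0))) (S.zeroʳ (const w ⊛ X 1))))
  M-partialSum (suc J) = begin
    M ⊛ (partialSum J ⊞ term J)                  ≈⟨ S.distribˡ M (partialSum J) (term J) ⟩
    M ⊛ partialSum J ⊞ M ⊛ term J                ≈⟨ S.+-cong (M-partialSum J) (M-term J) ⟩
    c ⊛ (U 0 ⊞ ⊟ U J) ⊞ c ⊛ (U J ⊞ ⊟ U (suc J))
      ≈⟨ solve 4 (λ c x y z → c :* (x :+ (:- y)) :+ c :* (y :+ (:- z)) := c :* (x :+ (:- z))) S.refl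
           c (U 0) (U J) (U (suc J)) ⟩
    c ⊛ (U 0 ⊞ ⊟ U (suc J))                      ∎
    where
    open ≈-Reasoning
    c = const w ⊛ X 1

  Low-U : ∀ J → Low J (U J)
  Low-U J = Low-⊛ (Low-⊛ (λ i i<J → lin-low w e i (ℕₚ.<-≤-trans i<J (n≤dbl J))) (Low-poch w (2 ℕ.+ e) 2 (bound 2)))
    (Low-⊛ (Low-poch w (4 ℕ.+ e) 2 (bound 4))
      (Low-⊛ (Low-invPoch (1 ℕ.+ e) 2 (bound 1)) (Low-invPoch (3 ℕ.+ e) 2 (bound 3))))
    where
    e = dbl J
    bound : ∀ k → J ℕ.≤ k ℕ.+ e
    bound k = ℕₚ.≤-trans (n≤dbl J) (ℕₚ.m≤n+m e k)

  -- Passage to the limit, one degree at a time: with `suc n` terms the partial sum is already exact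
  -- up to degree n, and `U (suc n)` is already 1 there.
  M-genS : M ⊛ genS ≈ (const w ⊛ X 1) ⊛ (U 0 ⊞ ⊟ oneS)
  M-genS = coeffs λ n → begin
    (M ⊛ genS) n
      ≡⟨ ⊛-cong-≤ {M} {M} {genS} {partialSum (suc n)} n (λ _ _ → refl)
           (λ i i≤n → trans (genS-∑ i (suc n) (s≤s i≤n)) (sym (partialSum-∑ (suc n) i))) ⟩
    (M ⊛ partialSum (suc n)) n                       ≡⟨ at (M-partialSum (suc n)) n ⟩
    (c ⊛ (U 0 ⊞ ⊟ U (suc n))) n
      ≡⟨ ⊛-cong-≤ {c} {c} {U 0 ⊞ ⊟ U (suc n)} {U 0 ⊞ ⊟ oneS} n (λ _ _ → refl)
           (λ i i≤n → cong (λ x → U 0 i + - x) (Low-U (suc n) i (s≤s i≤n))) ⟩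
    (c ⊛ (U 0 ⊞ ⊟ oneS)) n                           ∎
    where
    open ≡-Reasoning
    c = const w ⊛ X 1

-- Closed forms

powers : ℤ → Series
powers c n = c ℤ.^ n

powers-geom : ∀ c → powers c ≈ geom c 1
powers-geom c = S.trans (divide c 0 (S.trans (lin-⊛ (- c) 1 (powers c)) (coeffs step))) (S.*-identityʳ (geom c 1))
  where
  cancel : ∀ c x → c * x + - c * x ≡ 0ℤ
  cancel = solve-∀
  step : ∀ n → powers c n + (const (- c) ⊛ (X 1 ⊛ powers c)) n ≡ oneS n
  step zero    rewrite const-⊛ (- c) (X 1 ⊛ powers c) 0 | X-⊛-< 1 (powers c) 0 (s≤s z≤n) | ℤₚ.*-zeroʳ (- c) = refl
  step (suc n) rewrite const-⊛ (- c) (X 1 ⊛ powers c) (suc n) | X-⊛-+ 1 (powers c) n = cancel c (c ℤ.^ n)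

floorSeq-+3 : ∀ n → floorSeq (3 ℕ.+ n) ≡ suc (floorSeq n)
floorSeq-+3 n = +-distrib-/-∣ˡ {3} (n ℕ.+ 2) {3} ∣-refl

-- Multiplying by 1 - c q³ leaves the powers of c: the floor grows by one in three steps, and c³ = c
-- because c² = 1. The three initial values of the floor are all 1.
floorSeries : ∀ c → c * c ≡ 1ℤ → (λ n → c ℤ.^ n * (ℤ.+ floorSeq (suc n))) ≈ geom c 1 ⊛ geom c 3
floorSeries c c²≡1 = begin
  h                        ≈⟨ divide c 2 (S.trans (lin-⊛ (- c) 3 h) (coeffs step)) ⟩
  geom c 3 ⊛ powers c      ≈⟨ ⊛-congˡ (geom c 3) (powers-geom c) ⟩
  geom c 3 ⊛ geom c 1      ≈⟨ S.*-comm (geom c 3) (geom c 1) ⟩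
  geom c 1 ⊛ geom c 3      ∎
  where
  open ≈-Reasoning
  h : Series
  h n = c ℤ.^ n * (ℤ.+ floorSeq (suc n))
  initial : ∀ n → n ℕ.< 3 → (const (- c) ⊛ (X 3 ⊛ h)) n ≡ 0ℤ
  initial n n<3 = trans (const-⊛ (- c) (X 3 ⊛ h) n) (trans (cong (- c *_) (X-⊛-< 3 h n n<3)) (ℤₚ.*-zeroʳ (- c)))
  cube : ∀ x → c * (c * (c * x)) ≡ c * x
  cube x = trans (assoc c x) (trans (cong (_* (c * x)) c²≡1) (ℤₚ.*-identityˡ (c * x)))
    where
    assoc : ∀ c x → c * (c * (c * x)) ≡ (c * c) * (c * x)
    assoc = solve-∀
  collect : ∀ c x f → c * x * (1ℤ + f) + - c * (x * f) ≡ c * x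
  collect = solve-∀
  step : ∀ n → h n + (const (- c) ⊛ (X 3 ⊛ h)) n ≡ powers c n
  step 0 rewrite initial 0 (s≤s z≤n) = refl
  step 1 rewrite initial 1 (s≤s (s≤s z≤n)) = trans (ℤₚ.+-identityʳ _) (ℤₚ.*-identityʳ _)
  step 2 rewrite initial 2 (s≤s (s≤s (s≤s z≤n))) = trans (ℤₚ.+-identityʳ _) (ℤₚ.*-identityʳ _)
  step (suc (suc (suc n))) rewrite const-⊛ (- c) (X 3 ⊛ h) (3 ℕ.+ n) | X-⊛-+ 3 h n | cube (c ℤ.^ n)
    | floorSeq-+3 (suc n) = collect c (c ℤ.^ n) (ℤ.+ floorSeq (suc n))

qOver1m-floor : ∀ n → qOver1m n ≡ floorS n
qOver1m-floor zero    = refl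
qOver1m-floor (suc n) = trans (sym (at (floorSeries 1ℤ refl) n))
  (trans (cong (_* (ℤ.+ floorSeq (suc n))) (ℤₚ.^-zeroˡ n)) (ℤₚ.*-identityˡ _))

qOver1p-floor : ∀ n → - qOver1p n ≡ altFloorS n
qOver1p-floor zero    = refl
qOver1p-floor (suc n) = trans (cong -_ (sym (at (floorSeries (- 1ℤ) refl) n))) (negate ((- 1ℤ) ℤ.^ n) _)
  where
  negate : ∀ x y → - (x * y) ≡ - 1ℤ * x * y
  negate = solve-∀

-- The two choices of weight

module W₊ = TwoColorWeights 1ℤ
module W₋ = TwoColorWeights (- 1ℤ)
module T₊ = Telescope 1ℤ refl
module T₋ = Telescope (- 1ℤ) refl

genB-genS : genB ≈ W₊.genS
genB-genS = coeffs λ n → go (twoColorPartitions n)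
  where
  go : ∀ l → ℤ.+ length (filterB isB l) ≡ sumBy W₊.signed l
  go []      = refl
  go (π ∷ l) with isB π
  ... | true  = cong₂ _+_ (sym (ℤₚ.^-zeroˡ (numEven π))) (go l)
  ... | false = trans (go l) (sym (ℤₚ.+-identityˡ _))

genB'-genS : genB' ≈ W₋.genS
genB'-genS = coeffs λ n → go (twoColorPartitions n)
  where
  go : ∀ l → foldr (λ π r → (- 1ℤ) ℤ.^ numEven π + r) 0ℤ (filterB isB l) ≡ sumBy W₋.signed l
  go []      = refl
  go (π ∷ l) with isB π
  ... | true  = cong ((- 1ℤ) ℤ.^ numEven π +_) (go l)
  ... | false = trans (go l) (sym (ℤₚ.+-identityˡ _))

-- Clears the multiplier (1+wq)(1+wq³) of the telescoped sum, with c = -w.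
divide-13 : ∀ c {f g} → (lin (- c) 1 ⊛ lin (- c) 3) ⊛ f ≈ g → f ≈ (geom c 1 ⊛ geom c 3) ⊛ g
divide-13 c {f} {g} e = begin
  f                              ≈⟨ divide c 2 (divide c 0 (S.trans (S.sym (S.*-assoc (lin (- c) 1) (lin (- c) 3) f)) e)) ⟩
  geom c 3 ⊛ (geom c 1 ⊛ g)
    ≈⟨ solve 3 (λ a b c → a :* (b :* c) := (b :* a) :* c) S.refl (geom c 3) (geom c 1) g ⟩
  (geom c 1 ⊛ geom c 3) ⊛ g      ∎
  where open ≈-Reasoning

lin-at-zero : ∀ c → lin c 0 ≈ const (1ℤ + c)
lin-at-zero c = coeffs λ { zero → refl ; (suc _) → refl }

genB'-closed : genB' ≈ qOver1m
genB'-closed = begin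
  genB'                                                ≈⟨ genB'-genS ⟩
  W₋.genS                                              ≈⟨ divide-13 1ℤ T₋.M-genS ⟩
  g ⊛ ((const (- 1ℤ) ⊛ X 1) ⊛ ((lin (- 1ℤ) 0 ⊛ y) ⊛ z ⊞ ⊟ oneS))
    ≈⟨ ⊛-congˡ g (⊛-congˡ (const (- 1ℤ) ⊛ X 1)
         (S.+-cong (⊛-congʳ z (⊛-congʳ y (lin-at-zero (- 1ℤ)))) (S.-‿cong oneS-const))) ⟩
  g ⊛ ((const (- 1ℤ) ⊛ X 1) ⊛ ((const 0ℤ ⊛ y) ⊛ z ⊞ ⊟ const 1ℤ))
    ≈⟨ solve 4 (λ g x y z → g :* ((con (- 1ℤ) :* x) :* ((con 0ℤ :* y) :* z :+ (:- con 1ℤ))) := x :* g) S.refl g (X 1) y z ⟩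
  X 1 ⊛ g                                              ≈⟨ qS-X g ⟨
  qOver1m                                              ∎
  where
  open ≈-Reasoning
  g = geom 1ℤ 1 ⊛ geom 1ℤ 3
  y = T₋.P 2
  z = T₋.P 4 ⊛ (T₋.R 1 ⊛ T₋.R 3)

-- The odd-exponent halves (-q³;q²) and (-q⁵;q²) each lack one factor before they can cancel against
-- (q²;q⁴) and (q⁶;q⁴). Supplying 1+q and 1+q³ costs their reciprocals, which are exactly what
-- dividing by the telescoping multiplier produces.
mainProd-closed : mainProd ≈ (geom (- 1ℤ) 1 ⊛ geom (- 1ℤ) 3) ⊛ (T₊.P 2 ⊛ (T₊.P 4 ⊛ (T₊.R 1 ⊛ T₊.R 3)))
mainProd-closed = begin
  mainProd                                             ≈⟨ ⊛-cong (poch-dissect 1ℤ 1) (⊛-congʳ (I₂ ⊛ I₆) (poch-dissect 1ℤ 3)) ⟩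
  (P₂ ⊛ P₃) ⊛ ((P₄ ⊛ P₅) ⊛ (I₂ ⊛ I₆))
    -- The two units are placeholders, to become (1+q)/(1+q) and (1+q³)/(1+q³).
    ≈⟨ solve 6 (λ a b c d i j → (a :* b) :* ((c :* d) :* (i :* j))
         := (con 1ℤ :* con 1ℤ) :* (a :* (c :* ((i :* b) :* (j :* d))))) S.refl P₂ P₃ P₄ P₅ I₂ I₆ ⟩
  (const 1ℤ ⊛ const 1ℤ) ⊛ (P₂ ⊛ (P₄ ⊛ ((I₂ ⊛ P₃) ⊛ (I₆ ⊛ P₅))))
    ≈⟨ ⊛-congʳ (P₂ ⊛ (P₄ ⊛ ((I₂ ⊛ P₃) ⊛ (I₆ ⊛ P₅))))
         (⊛-cong (S.trans (S.sym oneS-const) (S.sym (lin-geom (- 1ℤ) 0))) (S.trans (S.sym oneS-const) (S.sym (lin-geom (- 1ℤ) 2)))) ⟩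
  ((l₁ ⊛ g₁) ⊛ (l₃ ⊛ g₃)) ⊛ (P₂ ⊛ (P₄ ⊛ ((I₂ ⊛ P₃) ⊛ (I₆ ⊛ P₅))))
    ≈⟨ solve 10 (λ k g l h a b c d i j → ((k :* g) :* (l :* h)) :* (a :* (c :* ((i :* b) :* (j :* d))))
         := (g :* h) :* (a :* (c :* ((i :* (k :* b)) :* (j :* (l :* d)))))) S.refl l₁ g₁ l₃ g₃ P₂ P₃ P₄ P₅ I₂ I₆ ⟩
  (g₁ ⊛ g₃) ⊛ (P₂ ⊛ (P₄ ⊛ ((I₂ ⊛ (l₁ ⊛ P₃)) ⊛ (I₆ ⊛ (l₃ ⊛ P₅)))))
    ≈⟨ ⊛-congˡ (g₁ ⊛ g₃) (⊛-congˡ P₂ (⊛-congˡ P₄ (⊛-cong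
         (S.trans (⊛-congˡ I₂ (S.sym (poch-split 1ℤ 0 1))) (invPoch-⊛-poch 0))
         (S.trans (⊛-congˡ I₆ (S.sym (poch-split 1ℤ 2 1))) (invPoch-⊛-poch 2))))) ⟩
  (g₁ ⊛ g₃) ⊛ (P₂ ⊛ (P₄ ⊛ (T₊.R 1 ⊛ T₊.R 3)))          ∎
  where
  open ≈-Reasoning
  g₁ = geom (- 1ℤ) 1
  g₃ = geom (- 1ℤ) 3
  l₁ = lin 1ℤ 1
  l₃ = lin 1ℤ 3
  P₂ = T₊.P 2
  P₃ = T₊.P 3
  P₄ = T₊.P 4
  P₅ = T₊.P 5
  I₂ = invPochMinus 2 4
  I₆ = invPochMinus 6 4

genB-closed : genB ≈ twoQMain ⊞ ⊟ qOver1p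
genB-closed = begin
  genB                                                 ≈⟨ genB-genS ⟩
  W₊.genS                                              ≈⟨ divide-13 (- 1ℤ) T₊.M-genS ⟩
  g ⊛ ((const 1ℤ ⊛ X 1) ⊛ ((lin 1ℤ 0 ⊛ y) ⊛ z ⊞ ⊟ oneS))
    ≈⟨ ⊛-congˡ g (⊛-congˡ (const 1ℤ ⊛ X 1)
         (S.+-cong (⊛-congʳ z (⊛-congʳ y (lin-at-zero 1ℤ))) (S.-‿cong oneS-const))) ⟩
  g ⊛ ((const 1ℤ ⊛ X 1) ⊛ ((const (ℤ.+ 2) ⊛ y) ⊛ z ⊞ ⊟ const 1ℤ))
    ≈⟨ solve 4 (λ g x y z → g :* ((con 1ℤ :* x) :* ((con (ℤ.+ 2) :* y) :* z :+ (:- con 1ℤ)))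
         := con (ℤ.+ 2) :* (x :* (g :* (y :* z))) :+ (:- (x :* g))) S.refl g (X 1) y z ⟩
  const (ℤ.+ 2) ⊛ (X 1 ⊛ (g ⊛ (y ⊛ z))) ⊞ ⊟ (X 1 ⊛ g)
    ≈⟨ S.+-cong (⊛-congˡ (const (ℤ.+ 2)) (⊛-congˡ (X 1) mainProd-closed)) (S.-‿cong (qS-X g)) ⟨
  const (ℤ.+ 2) ⊛ (X 1 ⊛ mainProd) ⊞ ⊟ qOver1p
    ≈⟨ S.+-cong (⊛-congˡ (const (ℤ.+ 2)) (qS-X mainProd)) (S.refl {⊟ qOver1p}) ⟨
  const (ℤ.+ 2) ⊛ qS mainProd ⊞ ⊟ qOver1p
    ≈⟨ coeffs (λ n → cong (_+ - qOver1p n) (const-⊛ (ℤ.+ 2) (qS mainProd) n)) ⟩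
  twoQMain ⊞ ⊟ qOver1p                                 ∎
  where
  open ≈-Reasoning
  g = geom (- 1ℤ) 1 ⊛ geom (- 1ℤ) 3
  y = T₊.P 2
  z = T₊.P 4 ⊛ (T₊.R 1 ⊛ T₊.R 3)

theorem6 : ((n : ℕ) → (genB n ≡ twoQMain n - qOver1p n) × (twoQMain n - qOver1p n ≡ twoQMain n + altFloorS n))
    × ((n : ℕ) → (genB' n ≡ qOver1m n) × (qOver1m n ≡ floorS n))
theorem6 = (λ n → at genB-closed n , cong (twoQMain n +_) (qOver1p-floor n))
         , (λ n → at genB'-closed n , qOver1m-floor n)
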